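{- For all $n\ge 3$, there is a Nullstellensatz proof of infeasibility of the ordering principle system $\mathrm{ORD}_n$ on $n$ elements whose size and whose total coefficient size are both equal to $2^n-n$.
   Context: Ordering principle system $\mathrm{ORD}_n$: there is a Boolean variable $x_{i,j}$ for each $i,j\in[n]$ with $i<j$; for $i<j$ write $x_{j,i}=1-x_{i,j}$. The (non-Boolean) axioms are: for each $i\in[n]$, $\prod_{j\in[n]\setminus\{i\}}x_{i,j}=0$ (non-minimality axioms); and for each $i<j<k$ in $[n]$, $x_{i,j}x_{j,k}x_{k,i}=0$ and $x_{k,j}x_{j,i}x_{i,k}=0$ (transitivity axioms). Boolean Nullstellensatz proofs: given Boolean variables $y_1,\dots,y_N$, a monomial is a product $\prod_{a\in S}y_a\prod_{b\in T}(1-y_b)$ with $S,T\subseteq[N]$ disjoint. Given axioms $p_1=0,\dots,p_m=0$, a Nullstellensatz proof of infeasibility is a polynomial identity $1=\sum_{i=1}^m p_iq_i+\sum_{a=1}^N g_a(y_a^2-y_a)$ with polynomials $q_i,g_a$ with real coefficients, where each $q_i$ is given as a real linear combination $q_i=\sum_r c_{ir}r$ of monomials $r$ of the form $\prod_{a\in S}y_a\prod_{b\in T}(1-y_b)$ with $S,T\subseteq[N]$ disjoint. Its total coefficient size is $\sum_{i}\sum_r|c_{ir}|$ (the Boolean axioms are used for free), and its size is the number of pairs $(i,r)$ with $c_{ir}\ne 0$, i.e. the number of weakenings $r p_i$ of axioms used. -}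

module Defs where

open import Level using (0ℓ)
open import Algebra.Bundles using (CommutativeRing)
open import Data.Nat as ℕ using (ℕ; zero; suc; s<s)
import Data.Nat.Properties as ℕ
import Data.Integer as ℤ
open import Data.Rational as ℚ using (ℚ; 0ℚ; 1ℚ; ½)
import Data.Rational.Properties as ℚ
open import Data.Rational.Properties using (module ≤-Reasoning)
open import Data.Rational.Solver using (module +-*-Solver)
open import Data.Fin as Fin using (Fin; zero; suc; _↑ˡ_; _↑ʳ_)
import Data.Fin.Properties as Fin
open import Data.Fin.Subset using (Subset; _∩_; Empty)
open import Data.Fin.Subset.Properties using (_∈?_)
open import Data.Vec as Vec using (Vec)
import Data.Vec.Properties as Vec
open import Data.List as List using (List; []; _∷_; _++_; map; filter; foldr; allFin; length; cartesianProduct; cartesianProductWith)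
open import Data.Nat.ListAction using (sum)
open import Data.List.Relation.Unary.All using (All)
open import Data.List.Relation.Unary.Unique.Propositional using (Unique)
open import Data.Product using (Σ; ∃; _×_; _,_; proj₁; proj₂)
open import Data.Sum using (inj₁; inj₂)
open import Relation.Binary.Definitions using (tri<; tri≈; tri>)
open import Relation.Binary.PropositionalEquality using (_≡_; refl; sym; trans; cong; cong₂; subst)
open import Relation.Nullary using (¬_)
open import Relation.Nullary.Decidable using (does; ¬?; _×-dec_)
open import Data.Bool using (if_then_else_)

------------------------------------------------------------------------
-- Real numbers: Cauchy sequences of rationals, as a setoid

private
  module Estimates where
    open import Data.Rational using (_+_; _*_; _-_; -_; ∣_∣; _<_; _≤_; Positive; positive)
    open ≤-Reasoning

    halves : ∀ ε → ε * ½ + ε * ½ ≡ ε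
    halves ε = trans (sym (ℚ.*-distribˡ-+ ε ½ ½)) (ℚ.*-identityʳ ε)

    *-pos : ∀ {p q} → 0ℚ < p → 0ℚ < q → 0ℚ < p * q
    *-pos {p} {q} 0<p 0<q =
      ℚ.positive⁻¹ (p * q) {{ℚ.pos*pos⇒pos p {{positive 0<p}} q {{positive 0<q}}}}

    half-pos : ∀ {ε} → 0ℚ < ε → 0ℚ < ε * ½
    half-pos 0<ε = *-pos 0<ε (ℚ.positive⁻¹ ½)

    dist-sym : ∀ p q → ∣ p - q ∣ ≡ ∣ q - p ∣
    dist-sym p q = trans (sym (ℚ.∣-p∣≡∣p∣ (p - q))) (cong ∣_∣
      (solve 2 (λ a b → :- (a :- b) := b :- a) refl p q))
      where open +-*-Solver

    dist-self : ∀ p → ∣ p - p ∣ ≡ 0ℚ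
    dist-self p = cong ∣_∣ (ℚ.+-inverseʳ p)

    dist-triangle : ∀ p q r → ∣ p - r ∣ ≤ ∣ p - q ∣ + ∣ q - r ∣
    dist-triangle p q r = subst (λ t → ∣ t ∣ ≤ ∣ p - q ∣ + ∣ q - r ∣)
      (solve 3 (λ a b c → (a :- b) :+ (b :- c) := a :- c) refl p q r)
      (ℚ.∣p+q∣≤∣p∣+∣q∣ (p - q) (q - r))
      where open +-*-Solver

    +-close : ∀ p q p′ q′ {ε} → ∣ p - p′ ∣ < ε * ½ → ∣ q - q′ ∣ < ε * ½ →
              ∣ (p + q) - (p′ + q′) ∣ < ε
    +-close p q p′ q′ {ε} h k = begin-strict
      ∣ (p + q) - (p′ + q′) ∣    ≡⟨ cong ∣_∣ (solve 4 (λ a b c d →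
                                      (a :+ b) :- (c :+ d) := (a :- c) :+ (b :- d)) refl p q p′ q′) ⟩
      ∣ (p - p′) + (q - q′) ∣    ≤⟨ ℚ.∣p+q∣≤∣p∣+∣q∣ (p - p′) (q - q′) ⟩
      ∣ p - p′ ∣ + ∣ q - q′ ∣    <⟨ ℚ.+-mono-< h k ⟩
      ε * ½ + ε * ½              ≡⟨ halves ε ⟩
      ε                          ∎
      where open +-*-Solver

    neg-close : ∀ p q → ∣ (- p) - (- q) ∣ ≡ ∣ p - q ∣
    neg-close p q = trans (cong ∣_∣ (solve 2 (λ a b → :- a :- :- b := b :- a) refl p q)) (dist-sym q p)
      where open +-*-Solver

    abs-diff : ∀ p q → ∣ p ∣ - ∣ q ∣ ≤ ∣ p - q ∣
    abs-diff p q = begin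
      ∣ p ∣ - ∣ q ∣                   ≡⟨ cong (λ t → ∣ t ∣ - ∣ q ∣)
                                          (solve 2 (λ a b → a := (a :- b) :+ b) refl p q) ⟩
      ∣ (p - q) + q ∣ - ∣ q ∣         ≤⟨ ℚ.+-monoˡ-≤ (- ∣ q ∣) (ℚ.∣p+q∣≤∣p∣+∣q∣ (p - q) q) ⟩
      (∣ p - q ∣ + ∣ q ∣) - ∣ q ∣     ≡⟨ solve 2 (λ a b → (a :+ b) :- b := a) refl ∣ p - q ∣ ∣ q ∣ ⟩
      ∣ p - q ∣                       ∎
      where open +-*-Solver

    abs-close : ∀ p q → ∣ ∣ p ∣ - ∣ q ∣ ∣ ≤ ∣ p - q ∣
    abs-close p q with ℚ.∣p∣≡p∨∣p∣≡-p (∣ p ∣ - ∣ q ∣)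
    ... | inj₁ eq = begin
      ∣ ∣ p ∣ - ∣ q ∣ ∣   ≡⟨ eq ⟩
      ∣ p ∣ - ∣ q ∣       ≤⟨ abs-diff p q ⟩
      ∣ p - q ∣           ∎
    ... | inj₂ eq = begin
      ∣ ∣ p ∣ - ∣ q ∣ ∣   ≡⟨ eq ⟩
      - (∣ p ∣ - ∣ q ∣)   ≡⟨ solve 2 (λ a b → :- (a :- b) := b :- a) refl ∣ p ∣ ∣ q ∣ ⟩
      ∣ q ∣ - ∣ p ∣       ≤⟨ abs-diff q p ⟩
      ∣ q - p ∣           ≡⟨ dist-sym q p ⟩
      ∣ p - q ∣           ∎
      where open +-*-Solver

    shrink : ∀ B ε → 0ℚ < B → 0ℚ < ε → Σ ℚ λ δ → 0ℚ < δ ×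
             (∀ p q → ∣ p ∣ ≤ B → ∣ q ∣ < δ → ∣ p ∣ * ∣ q ∣ < ε)
    shrink B ε 0<B 0<ε = ε * B⁻¹ , *-pos 0<ε (ℚ.positive⁻¹ B⁻¹ {{ℚ.1/pos⇒pos B {{B>0}}}}) , bound
      where
      B>0 : Positive B
      B>0 = positive 0<B
      B⁻¹ : ℚ
      B⁻¹ = (ℚ.1/ B) {{ℚ.pos⇒nonZero B {{B>0}}}}
      bound : ∀ p q → ∣ p ∣ ≤ B → ∣ q ∣ < ε * B⁻¹ → ∣ p ∣ * ∣ q ∣ < ε
      bound p q p≤B q<δ = begin-strict
        ∣ p ∣ * ∣ q ∣     ≤⟨ ℚ.*-monoʳ-≤-nonNeg ∣ q ∣ {{ℚ.∣-∣-nonNeg q}} p≤B ⟩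
        B * ∣ q ∣         <⟨ ℚ.*-monoʳ-<-pos B {{B>0}} q<δ ⟩
        B * (ε * B⁻¹)     ≡⟨ solve 3 (λ b e c → b :* (e :* c) := e :* (b :* c)) refl B ε B⁻¹ ⟩
        ε * (B * B⁻¹)     ≡⟨ cong (ε *_) (ℚ.*-inverseʳ B {{ℚ.pos⇒nonZero B {{B>0}}}}) ⟩
        ε * 1ℚ            ≡⟨ ℚ.*-identityʳ ε ⟩
        ε                 ∎
        where open +-*-Solver

    *-split : ∀ p q p′ q′ → p * q - p′ * q′ ≡ p * (q - q′) + q′ * (p - p′)
    *-split p q p′ q′ = begin-equality
      p * q - p′ * q′                          ≡⟨ solve 3 (λ a b c → a :- b := (a :- c) :+ (c :- b)) refl (p * q) (p′ * q′) (p * q′) ⟩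
      (p * q - p * q′) + (p * q′ - p′ * q′)    ≡⟨ cong₂ _+_
                                                   (solve 3 (λ a b c → a :* b :- a :* c := a :* (b :- c)) refl p q q′)
                                                   (solve 3 (λ a b c → a :* b :- c :* b := b :* (a :- c)) refl p q′ p′) ⟩
      p * (q - q′) + q′ * (p - p′)             ∎
      where open +-*-Solver

    *-close : ∀ B C ε → 0ℚ < B → 0ℚ < C → 0ℚ < ε → Σ ℚ λ δ → Σ ℚ λ η → 0ℚ < δ × 0ℚ < η ×
              (∀ p q p′ q′ → ∣ p ∣ ≤ B → ∣ q′ ∣ ≤ C → ∣ q - q′ ∣ < δ → ∣ p - p′ ∣ < η →
               ∣ p * q - p′ * q′ ∣ < ε)
    *-close B C ε 0<B 0<C 0<ε =
      let (δ , 0<δ , boundδ) = shrink B (ε * ½) 0<B (half-pos 0<ε)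
          (η , 0<η , boundη) = shrink C (ε * ½) 0<C (half-pos 0<ε)
      in δ , η , 0<δ , 0<η , λ p q p′ q′ p≤B q′≤C q≈q′ p≈p′ →
           combine p q p′ q′ (boundδ p (q - q′) p≤B q≈q′) (boundη q′ (p - p′) q′≤C p≈p′)
      where
      combine : ∀ p q p′ q′ → ∣ p ∣ * ∣ q - q′ ∣ < ε * ½ → ∣ q′ ∣ * ∣ p - p′ ∣ < ε * ½ →
                ∣ p * q - p′ * q′ ∣ < ε
      combine p q p′ q′ h k = begin-strict
        ∣ p * q - p′ * q′ ∣
          ≡⟨ cong ∣_∣ (*-split p q p′ q′) ⟩
        ∣ p * (q - q′) + q′ * (p - p′) ∣
          ≤⟨ ℚ.∣p+q∣≤∣p∣+∣q∣ (p * (q - q′)) (q′ * (p - p′)) ⟩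
        ∣ p * (q - q′) ∣ + ∣ q′ * (p - p′) ∣
          ≡⟨ cong₂ _+_ (ℚ.∣p*q∣≡∣p∣*∣q∣ p (q - q′)) (ℚ.∣p*q∣≡∣p∣*∣q∣ q′ (p - p′)) ⟩
        ∣ p ∣ * ∣ q - q′ ∣ + ∣ q′ ∣ * ∣ p - p′ ∣
          <⟨ ℚ.+-mono-< h k ⟩
        ε * ½ + ε * ½
          ≡⟨ halves ε ⟩
        ε ∎

  open Estimates

record ℝ : Set where
  field
    seq    : ℕ → ℚ
    cauchy : ∀ ε → 0ℚ ℚ.< ε → ∃ λ N → ∀ m n → N ℕ.≤ m → N ℕ.≤ n → ℚ.∣ seq m ℚ.- seq n ∣ ℚ.< ε

open ℝ

infix  4 _≈ℝ_
infixl 6 _+ℝ_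
infixl 7 _*ℝ_
infix  8 -ℝ_

_≈ℝ_ : ℝ → ℝ → Set
x ≈ℝ y = ∀ ε → 0ℚ ℚ.< ε → ∃ λ N → ∀ n → N ℕ.≤ n → ℚ.∣ seq x n ℚ.- seq y n ∣ ℚ.< ε

fromℚ : ℚ → ℝ
fromℚ p = record
  { seq    = λ _ → p
  ; cauchy = λ ε 0<ε → 0 , λ _ _ _ _ → subst (ℚ._< ε) (sym (dist-self p)) 0<ε
  }

fromℕ : ℕ → ℝ
fromℕ k = fromℚ ((ℤ.+ k) ℚ./ 1)

0ℝ 1ℝ : ℝ
0ℝ = fromℚ 0ℚ
1ℝ = fromℚ 1ℚ

_+ℝ_ : ℝ → ℝ → ℝ
x +ℝ y = record
  { seq    = λ n → seq x n ℚ.+ seq y n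
  ; cauchy = λ ε 0<ε →
      let (M , hM) = cauchy x (ε ℚ.* ½) (half-pos 0<ε)
          (N , hN) = cauchy y (ε ℚ.* ½) (half-pos 0<ε)
      in M ℕ.⊔ N , λ m n h k →
           +-close (seq x m) (seq y m) (seq x n) (seq y n)
             (hM m n (ℕ.m⊔n≤o⇒m≤o M N h) (ℕ.m⊔n≤o⇒m≤o M N k))
             (hN m n (ℕ.m⊔n≤o⇒n≤o M N h) (ℕ.m⊔n≤o⇒n≤o M N k))
  }

-ℝ_ : ℝ → ℝ
-ℝ x = record
  { seq    = λ n → ℚ.- seq x n
  ; cauchy = λ ε 0<ε →
      let (N , hN) = cauchy x ε 0<ε
      in N , λ m n h k → subst (ℚ._< ε) (sym (neg-close (seq x m) (seq x n))) (hN m n h k)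
  }

∣_∣ℝ : ℝ → ℝ
∣ x ∣ℝ = record
  { seq    = λ n → ℚ.∣ seq x n ∣
  ; cauchy = λ ε 0<ε →
      let (N , hN) = cauchy x ε 0<ε
      in N , λ m n h k → ℚ.≤-<-trans (abs-close (seq x m) (seq x n)) (hN m n h k)
  }

private
  eventualBound : ∀ x → ∃ λ B → 0ℚ ℚ.< B × ∃ λ N → ∀ n → N ℕ.≤ n → ℚ.∣ seq x n ∣ ℚ.≤ B
  eventualBound x = B , 0<B , N , bound
    where
    N : ℕ
    N = proj₁ (cauchy x 1ℚ (ℚ.positive⁻¹ 1ℚ))
    open ≤-Reasoning
    B : ℚ
    B = 1ℚ ℚ.+ ℚ.∣ seq x N ∣
    0<B : 0ℚ ℚ.< B
    0<B = ℚ.+-mono-<-≤ (ℚ.positive⁻¹ 1ℚ) (ℚ.0≤∣p∣ (seq x N))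
    bound : ∀ n → N ℕ.≤ n → ℚ.∣ seq x n ∣ ℚ.≤ B
    bound n N≤n = begin
      ℚ.∣ seq x n ∣                                           ≡⟨ cong ℚ.∣_∣ (solve 2 (λ a b → a := (a :- b) :+ b) refl (seq x n) (seq x N)) ⟩
      ℚ.∣ (seq x n ℚ.- seq x N) ℚ.+ seq x N ∣                 ≤⟨ ℚ.∣p+q∣≤∣p∣+∣q∣ (seq x n ℚ.- seq x N) (seq x N) ⟩
      ℚ.∣ seq x n ℚ.- seq x N ∣ ℚ.+ ℚ.∣ seq x N ∣             ≤⟨ ℚ.+-monoˡ-≤ ℚ.∣ seq x N ∣ (ℚ.<⇒≤ (proj₂ (cauchy x 1ℚ (ℚ.positive⁻¹ 1ℚ)) n N N≤n ℕ.≤-refl)) ⟩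
      B                                                       ∎
      where open +-*-Solver

_*ℝ_ : ℝ → ℝ → ℝ
x *ℝ y = record { seq = λ n → seq x n ℚ.* seq y n ; cauchy = isCauchy }
  where
  isCauchy : ∀ ε → 0ℚ ℚ.< ε → ∃ λ N → ∀ m n → N ℕ.≤ m → N ℕ.≤ n →
             ℚ.∣ seq x m ℚ.* seq y m ℚ.- seq x n ℚ.* seq y n ∣ ℚ.< ε
  isCauchy ε 0<ε =
    let (B , 0<B , K , hK) = eventualBound x
        (C , 0<C , L , hL) = eventualBound y
        (δ , η , 0<δ , 0<η , close) = *-close B C ε 0<B 0<C 0<ε
        (M , hM) = cauchy y δ 0<δ
        (N , hN) = cauchy x η 0<η
    in (K ℕ.⊔ L) ℕ.⊔ (M ℕ.⊔ N) , λ m n h k →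
       let h₁ = ℕ.m⊔n≤o⇒m≤o (K ℕ.⊔ L) (M ℕ.⊔ N) h ; h₂ = ℕ.m⊔n≤o⇒n≤o (K ℕ.⊔ L) (M ℕ.⊔ N) h
           k₁ = ℕ.m⊔n≤o⇒m≤o (K ℕ.⊔ L) (M ℕ.⊔ N) k ; k₂ = ℕ.m⊔n≤o⇒n≤o (K ℕ.⊔ L) (M ℕ.⊔ N) k
       in close (seq x m) (seq y m) (seq x n) (seq y n)
            (hK m (ℕ.m⊔n≤o⇒m≤o K L h₁)) (hL n (ℕ.m⊔n≤o⇒n≤o K L k₁))
            (hM m n (ℕ.m⊔n≤o⇒m≤o M N h₂) (ℕ.m⊔n≤o⇒m≤o M N k₂))
            (hN m n (ℕ.m⊔n≤o⇒n≤o M N h₂) (ℕ.m⊔n≤o⇒n≤o M N k₂))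

pointwise⇒≈ℝ : ∀ x y → (∀ n → seq x n ≡ seq y n) → x ≈ℝ y
pointwise⇒≈ℝ x y x≡y ε 0<ε = 0 , λ n _ → subst (ℚ._< ε)
  (sym (trans (cong (λ t → ℚ.∣ t ℚ.- seq y n ∣) (x≡y n)) (dist-self (seq y n)))) 0<ε

≈ℝ-refl : ∀ {x} → x ≈ℝ x
≈ℝ-refl {x} = pointwise⇒≈ℝ x x (λ _ → refl)

≈ℝ-sym : ∀ {x y} → x ≈ℝ y → y ≈ℝ x
≈ℝ-sym {x} {y} x≈y ε 0<ε = let (N , hN) = x≈y ε 0<ε in
  N , λ n h → subst (ℚ._< ε) (dist-sym (seq x n) (seq y n)) (hN n h)

≈ℝ-trans : ∀ {x y z} → x ≈ℝ y → y ≈ℝ z → x ≈ℝ z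
≈ℝ-trans {x} {y} {z} x≈y y≈z ε 0<ε =
  let (M , hM) = x≈y (ε ℚ.* ½) (half-pos 0<ε)
      (N , hN) = y≈z (ε ℚ.* ½) (half-pos 0<ε)
  in M ℕ.⊔ N , λ n h → ℚ.≤-<-trans (dist-triangle (seq x n) (seq y n) (seq z n))
       (subst (_ ℚ.<_) (halves ε)
         (ℚ.+-mono-< (hM n (ℕ.m⊔n≤o⇒m≤o M N h)) (hN n (ℕ.m⊔n≤o⇒n≤o M N h))))

+ℝ-cong : ∀ {x y u v} → x ≈ℝ y → u ≈ℝ v → x +ℝ u ≈ℝ y +ℝ v
+ℝ-cong {x} {y} {u} {v} x≈y u≈v ε 0<ε =
  let (M , hM) = x≈y (ε ℚ.* ½) (half-pos 0<ε)
      (N , hN) = u≈v (ε ℚ.* ½) (half-pos 0<ε)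
  in M ℕ.⊔ N , λ n h → +-close (seq x n) (seq u n) (seq y n) (seq v n)
       (hM n (ℕ.m⊔n≤o⇒m≤o M N h)) (hN n (ℕ.m⊔n≤o⇒n≤o M N h))

-ℝ-cong : ∀ {x y} → x ≈ℝ y → -ℝ x ≈ℝ -ℝ y
-ℝ-cong {x} {y} x≈y ε 0<ε = let (N , hN) = x≈y ε 0<ε in
  N , λ n h → subst (ℚ._< ε) (sym (neg-close (seq x n) (seq y n))) (hN n h)

∣∣ℝ-cong : ∀ {x y} → x ≈ℝ y → ∣ x ∣ℝ ≈ℝ ∣ y ∣ℝ
∣∣ℝ-cong {x} {y} x≈y ε 0<ε = let (N , hN) = x≈y ε 0<ε in
  N , λ n h → ℚ.≤-<-trans (abs-close (seq x n) (seq y n)) (hN n h)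

*ℝ-cong : ∀ {x y u v} → x ≈ℝ y → u ≈ℝ v → x *ℝ u ≈ℝ y *ℝ v
*ℝ-cong {x} {y} {u} {v} x≈y u≈v ε 0<ε =
  let (B , 0<B , K , hK) = eventualBound x
      (C , 0<C , L , hL) = eventualBound v
      (δ , η , 0<δ , 0<η , close) = *-close B C ε 0<B 0<C 0<ε
      (M , hM) = u≈v δ 0<δ
      (N , hN) = x≈y η 0<η
  in (K ℕ.⊔ L) ℕ.⊔ (M ℕ.⊔ N) , λ n h →
     let h₁ = ℕ.m⊔n≤o⇒m≤o (K ℕ.⊔ L) (M ℕ.⊔ N) h ; h₂ = ℕ.m⊔n≤o⇒n≤o (K ℕ.⊔ L) (M ℕ.⊔ N) h
     in close (seq x n) (seq u n) (seq y n) (seq v n)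
          (hK n (ℕ.m⊔n≤o⇒m≤o K L h₁)) (hL n (ℕ.m⊔n≤o⇒n≤o K L h₁))
          (hM n (ℕ.m⊔n≤o⇒m≤o M N h₂)) (hN n (ℕ.m⊔n≤o⇒n≤o M N h₂))

ℝ-commutativeRing : CommutativeRing 0ℓ 0ℓ
ℝ-commutativeRing = record
  { Carrier = ℝ ; _≈_ = _≈ℝ_ ; _+_ = _+ℝ_ ; _*_ = _*ℝ_ ; -_ = -ℝ_ ; 0# = 0ℝ ; 1# = 1ℝ
  ; isCommutativeRing = record
    { isRing = record
      { +-isAbelianGroup = record
        { isGroup = record
          { isMonoid = record
            { isSemigroup = record
              { isMagma = record
                { isEquivalence = record
                  { refl  = λ {x} → ≈ℝ-refl {x}
                  ; sym   = λ {x} {y} → ≈ℝ-sym {x} {y}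
                  ; trans = λ {x} {y} {z} → ≈ℝ-trans {x} {y} {z}
                  }
                ; ∙-cong = λ {x} {y} {u} {v} → +ℝ-cong {x} {y} {u} {v}
                }
              ; assoc = λ x y z → pointwise⇒≈ℝ (x +ℝ y +ℝ z) (x +ℝ (y +ℝ z))
                                    (λ n → ℚ.+-assoc (seq x n) (seq y n) (seq z n))
              }
            ; identity = (λ x → pointwise⇒≈ℝ (0ℝ +ℝ x) x (λ n → ℚ.+-identityˡ (seq x n)))
                       , (λ x → pointwise⇒≈ℝ (x +ℝ 0ℝ) x (λ n → ℚ.+-identityʳ (seq x n)))
            }
          ; inverse = (λ x → pointwise⇒≈ℝ (-ℝ x +ℝ x) 0ℝ (λ n → ℚ.+-inverseˡ (seq x n)))
                    , (λ x → pointwise⇒≈ℝ (x +ℝ -ℝ x) 0ℝ (λ n → ℚ.+-inverseʳ (seq x n)))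
          ; ⁻¹-cong = λ {x} {y} → -ℝ-cong {x} {y}
          }
        ; comm = λ x y → pointwise⇒≈ℝ (x +ℝ y) (y +ℝ x) (λ n → ℚ.+-comm (seq x n) (seq y n))
        }
      ; *-cong = λ {x} {y} {u} {v} → *ℝ-cong {x} {y} {u} {v}
      ; *-assoc = λ x y z → pointwise⇒≈ℝ (x *ℝ y *ℝ z) (x *ℝ (y *ℝ z))
                              (λ n → ℚ.*-assoc (seq x n) (seq y n) (seq z n))
      ; *-identity = (λ x → pointwise⇒≈ℝ (1ℝ *ℝ x) x (λ n → ℚ.*-identityˡ (seq x n)))
                   , (λ x → pointwise⇒≈ℝ (x *ℝ 1ℝ) x (λ n → ℚ.*-identityʳ (seq x n)))
      ; distrib = (λ x y z → pointwise⇒≈ℝ (x *ℝ (y +ℝ z)) (x *ℝ y +ℝ x *ℝ z)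
                               (λ n → ℚ.*-distribˡ-+ (seq x n) (seq y n) (seq z n)))
                , (λ x y z → pointwise⇒≈ℝ ((y +ℝ z) *ℝ x) (y *ℝ x +ℝ z *ℝ x)
                               (λ n → ℚ.*-distribʳ-+ (seq x n) (seq y n) (seq z n)))
      }
    ; *-comm = λ x y → pointwise⇒≈ℝ (x *ℝ y) (y *ℝ x) (λ n → ℚ.*-comm (seq x n) (seq y n))
    }
  }

------------------------------------------------------------------------
-- Polynomials in N variables: finite formal sums of terms c · y^e, where
-- e : Vec ℕ N is the vector of exponents. Terms may repeat and may have
-- zero coefficient; two polynomials are equal when all their
-- coefficients agree.

module Polynomials {c ℓ} (R : CommutativeRing c ℓ) where
  private module R = CommutativeRing R

  infix  4 _≈ₚ_
  infixl 6 _+ₚ_ _-ₚ_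
  infixl 7 _*ₚ_

  Poly : ℕ → Set c
  Poly N = List (R.Carrier × Vec ℕ N)

  coeff : ∀ {N} → Poly N → Vec ℕ N → R.Carrier
  coeff []            e = R.0#
  coeff ((a , d) ∷ p) e =
    if does (Vec.≡-dec ℕ._≟_ d e) then a R.+ coeff p e else coeff p e

  _≈ₚ_ : ∀ {N} → Poly N → Poly N → Set ℓ
  p ≈ₚ q = ∀ e → coeff p e R.≈ coeff q e

  const : ∀ {N} → R.Carrier → Poly N
  const a = (a , Vec.replicate _ 0) ∷ []

  0ₚ 1ₚ : ∀ {N} → Poly N
  0ₚ = []
  1ₚ = const R.1#

  var : ∀ {N} → Fin N → Poly N
  var a = (R.1# , Vec.replicate _ 0 Vec.[ a ]≔ 1) ∷ []

  _+ₚ_ _*ₚ_ _-ₚ_ : ∀ {N} → Poly N → Poly N → Poly N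
  p +ₚ q = p ++ q
  p *ₚ q = cartesianProductWith (λ (a , d) (b , e) → a R.* b , Vec.zipWith ℕ._+_ d e) p q
  p -ₚ q = p +ₚ const (R.- R.1#) *ₚ q

  ∑ₚ ∏ₚ : ∀ {N} → List (Poly N) → Poly N
  ∑ₚ = foldr _+ₚ_ 0ₚ
  ∏ₚ = foldr _*ₚ_ 1ₚ

open Polynomials ℝ-commutativeRing public

-- Disjointness is irrelevant so that monomials are equal exactly when
-- their sets S and T are.
record Monomial (N : ℕ) : Set where
  constructor monomial
  field
    S T       : Subset N
    .disjoint : Empty (S ∩ T)

monomialPoly : ∀ {N} → Monomial N → Poly N
monomialPoly {N} (monomial S T _) =
  ∏ₚ (map var (filter (_∈? S) (allFin N))) *ₚ
  ∏ₚ (map (λ b → 1ₚ -ₚ var b) (filter (_∈? T) (allFin N)))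

-- A real linear combination of monomials, listed by its support: each
-- monomial occurs at most once, and only with nonzero coefficient, so
-- that the number of r with c_r ≠ 0 is the length of the list.
record LinearCombination (N : ℕ) : Set where
  field
    terms    : List (ℝ × Monomial N)
    distinct : Unique (map proj₂ terms)
    nonzero  : All (λ (c , _) → ¬ c ≈ℝ 0ℝ) terms

open LinearCombination public

combinationPoly : ∀ {N} → LinearCombination N → Poly N
combinationPoly q = ∑ₚ (map (λ (c , r) → const c *ₚ monomialPoly r) (terms q))

∑ℝ : List ℝ → ℝ
∑ℝ = foldr _+ℝ_ 0ℝ

record NullstellensatzProof {N m : ℕ} (p : Fin m → Poly N) : Set where
  field
    q        : Fin m → LinearCombination N
    g        : Fin N → Poly N
    identity : 1ₚ ≈ₚ ∑ₚ (map (λ i → p i *ₚ combinationPoly (q i)) (allFin m))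
                  +ₚ ∑ₚ (map (λ a → g a *ₚ (var a *ₚ var a -ₚ var a)) (allFin N))

  size : ℕ
  size = sum (map (λ i → length (terms (q i))) (allFin m))

  totalCoefficientSize : ℝ
  totalCoefficientSize =
    ∑ℝ (map (λ i → ∑ℝ (map (λ (c , _) → ∣ c ∣ℝ) (terms (q i)))) (allFin m))

open NullstellensatzProof public

numPairs : ℕ → ℕ
numPairs zero    = 0
numPairs (suc n) = n ℕ.+ numPairs n

-- A bijection: it numbers the pairs i < j in lexicographic order.
pairIndex : ∀ {n} (i j : Fin n) → i Fin.< j → Fin (numPairs n)
pairIndex {suc n} zero    (suc j) _         = j ↑ˡ numPairs n
pairIndex {suc n} (suc i) (suc j) (s<s i<j) = n ↑ʳ pairIndex i j i<j

-- The value on the diagonal is a dummy: only x i j with i ≢ j is used.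
x : ∀ {n} → Fin n → Fin n → Poly (numPairs n)
x i j with Fin.<-cmp i j
... | tri< i<j _ _ = var (pairIndex i j i<j)
... | tri≈ _ _ _   = 0ₚ
... | tri> _ _ j<i = 1ₚ -ₚ var (pairIndex j i j<i)

nonMinimality : ∀ {n} → Fin n → Poly (numPairs n)
nonMinimality {n} i = ∏ₚ (map (x i) (filter (λ j → ¬? (j Fin.≟ i)) (allFin n)))

increasingTriples : ∀ n → List (Fin n × Fin n × Fin n)
increasingTriples n =
  filter (λ (i , j , k) → (i Fin.<? j) ×-dec (j Fin.<? k))
         (cartesianProduct (allFin n) (cartesianProduct (allFin n) (allFin n)))

transitivity₁ transitivity₂ : ∀ {n} → Fin n × Fin n × Fin n → Poly (numPairs n)
transitivity₁ (i , j , k) = x i j *ₚ x j k *ₚ x k i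
transitivity₂ (i , j , k) = x k j *ₚ x j i *ₚ x i k

ordAxioms : ∀ n → List (Poly (numPairs n))
ordAxioms n = map nonMinimality (allFin n)
           ++ map transitivity₁ (increasingTriples n)
           ++ map transitivity₂ (increasingTriples n)

ORD : ∀ n → Fin (length (ordAxioms n)) → Poly (numPairs n)
ORD n = List.lookup (ordAxioms n)

{-# OPTIONS --safe #-}
module Submission where

-- Play a king-of-the-hill tournament: the champion w meets the next element
-- v, and the winner goes on to the remaining elements R. Splitting on the
-- outcome with x w v + x v w = 1 and expanding each branch recursively, a
-- term "i is the source of the winner and R" with i in R either extends to
-- "i is the source of w, v and R" or contains a cycle through w, v and i. The
-- two branches together give each source term with coefficient exactly 1, so
--
--   1 = ∑ (non-minimality axioms) + ∑ (weakened transitivity axioms)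
--
-- holds as a polynomial identity even without the Boolean axioms, and all
-- coefficients are 1. With r elements in R after the match, the number of
-- weakened transitivity axioms satisfies c (1 + r) = 2 * c r + 2 * r, whence
-- c (n - 1) = 2 ^ n - 2 * n, and the n non-minimality axioms make 2 ^ n - n.

open import Algebra.Bundles using (CommutativeMonoid; CommutativeRing)
open import Data.Bool using (Bool; true; false; if_then_else_)
open import Data.Empty using (⊥; ⊥-elim)
open import Data.Fin as Fin using (Fin; zero; suc)
import Data.Fin.Properties as Fin
open import Data.Fin.Subset using (Subset)
open import Data.Fin.Subset.Properties using (_∈?_; x∈p∩q⁻)
import Data.Integer as ℤ
import Data.Integer.Properties as ℤ
open import Data.List as List using (List; []; _∷_; _++_; allFin; filter; foldr; length; map; tabulate)
import Data.List.Properties as List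
open import Data.List.Membership.Propositional using (_∈_)
open import Data.List.Membership.Propositional.Properties using (∈-allFin; ∈-filter⁺; ∈-filter⁻; ∈-cartesianProduct⁺; ∈-map⁺; ∈-map⁻; ∈-++⁺ˡ; ∈-++⁺ʳ; ∈-++⁻)
open import Data.List.Relation.Binary.Disjoint.Propositional using (Disjoint)
open import Data.List.Relation.Unary.All as All using (All; []; _∷_)
import Data.List.Relation.Unary.All.Properties as All
open import Data.List.Relation.Unary.AllPairs as AllPairs using (AllPairs; []; _∷_)
import Data.List.Relation.Unary.AllPairs.Properties as AllPairs
open import Data.List.Relation.Unary.Any using (here; there)
open import Data.List.Relation.Unary.Unique.Propositional using (Unique)
import Data.List.Relation.Unary.Unique.Propositional.Properties as Unique
open import Data.Maybe using (Maybe; just; nothing)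
open import Data.Nat as ℕ using (ℕ; _≤_; _^_; _∸_; zero; suc; s<s)
open import Data.Nat.ListAction using (sum)
import Data.Nat.Properties as ℕ
open import Data.Nat.Tactic.RingSolver using (solve-∀)
open import Data.Product using (Σ; _×_; _,_; proj₁; proj₂)
import Data.Product.Properties as Product
open import Data.Rational as ℚ using (1ℚ)
import Data.Rational.Properties as ℚ
import Data.Rational.Unnormalised as ℚᵘ
import Data.Rational.Unnormalised.Properties as ℚᵘ
open import Data.Sum using (_⊎_; inj₁; inj₂; [_,_])
import Data.Sum.Properties as Sum
open import Data.Unit using (⊤)
open import Data.Vec as Vec using (Vec; lookup; _[_]≔_)
import Data.Vec.Properties as Vec
open import Function using (_∘_)
open import Function.Bundles using (mk⇔)
open import Level using (Level)
open import Relation.Binary.Definitions using (DecidableEquality; Tri; tri<; tri≈; tri>)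
open import Relation.Binary.PropositionalEquality as ≡ using (_≡_; _≢_; refl; cong; cong₂)
open import Relation.Nullary using (¬_; yes; no)
open import Relation.Nullary.Decidable using (does; does-⇔; dec-false; ¬?)
open import Relation.Unary using (Decidable)
open import Defs

private
  variable
    a b c : Level
    A : Set a
    B : Set b
    C : Set c

-- The ring of polynomials

module PolynomialRing {c ℓ} (R : CommutativeRing c ℓ) where
  private module R = CommutativeRing R
  open CommutativeRing R using (Carrier; _≈_; _+_; _*_; -_; 0#; 1#)
  open import Algebra.Properties.Ring R.ring using (-1*x≈-x)
  open import Algebra.Properties.CommutativeSemigroup
    (CommutativeMonoid.commutativeSemigroup R.+-commutativeMonoid) using (interchange)
  open import Algebra.Properties.CommutativeSemigroup
    (CommutativeMonoid.commutativeSemigroup R.*-commutativeMonoid) using (x∙yz≈y∙xz)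
  open import Relation.Binary.Reasoning.Setoid R.setoid
  module P = Polynomials R

  _⊕_ : ∀ {N} → Vec ℕ N → Vec ℕ N → Vec ℕ N
  _⊕_ = Vec.zipWith ℕ._+_

  -- The linear functional y^d ↦ φ d. Coefficients are the case φ = δ e, and
  -- the ring laws are easier to prove for arbitrary φ.
  ev : ∀ {N} → (Vec ℕ N → Carrier) → P.Poly N → Carrier
  ev φ []            = 0#
  ev φ ((b , d) ∷ p) = b * φ d + ev φ p

  δ : ∀ {N} → Vec ℕ N → Vec ℕ N → Carrier
  δ e d = if does (Vec.≡-dec ℕ._≟_ d e) then 1# else 0#

  coeff≈ev : ∀ {N} (p : P.Poly N) e → P.coeff p e ≈ ev (δ e) p
  coeff≈ev []            e = R.refl
  coeff≈ev ((b , d) ∷ p) e with does (Vec.≡-dec ℕ._≟_ d e)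
  ... | true  = R.+-cong (R.sym (R.*-identityʳ b)) (coeff≈ev p e)
  ... | false = R.trans (coeff≈ev p e) (R.sym (R.trans (R.+-congʳ (R.zeroʳ b)) (R.+-identityˡ _)))

  ev-cong : ∀ {N} {φ ψ : Vec ℕ N → Carrier} (p : P.Poly N) →
            (∀ d → φ d ≈ ψ d) → ev φ p ≈ ev ψ p
  ev-cong []            φ≈ψ = R.refl
  ev-cong ((b , d) ∷ p) φ≈ψ = R.+-cong (R.*-congˡ (φ≈ψ d)) (ev-cong p φ≈ψ)

  ev-++ : ∀ {N} (φ : Vec ℕ N → Carrier) p q → ev φ (p ++ q) ≈ ev φ p + ev φ q
  ev-++ φ []            q = R.sym (R.+-identityˡ _)
  ev-++ φ ((b , d) ∷ p) q = R.trans (R.+-congˡ (ev-++ φ p q)) (R.sym (R.+-assoc _ _ _))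

  ev-zero : ∀ {N} (p : P.Poly N) → ev (λ _ → 0#) p ≈ 0#
  ev-zero []            = R.refl
  ev-zero ((b , d) ∷ p) = R.trans (R.+-cong (R.zeroʳ b) (ev-zero p)) (R.+-identityˡ 0#)

  ev-+ : ∀ {N} (φ ψ : Vec ℕ N → Carrier) p → ev (λ d → φ d + ψ d) p ≈ ev φ p + ev ψ p
  ev-+ φ ψ []            = R.sym (R.+-identityˡ 0#)
  ev-+ φ ψ ((b , d) ∷ p) = begin
    b * (φ d + ψ d) + ev (λ d → φ d + ψ d) p    ≈⟨ R.+-cong (R.distribˡ _ _ _) (ev-+ φ ψ p) ⟩
    (b * φ d + b * ψ d) + (ev φ p + ev ψ p)     ≈⟨ interchange _ _ _ _ ⟩
    (b * φ d + ev φ p) + (b * ψ d + ev ψ p)     ∎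

  ev-* : ∀ {N} b (φ : Vec ℕ N → Carrier) p → ev (λ d → b * φ d) p ≈ b * ev φ p
  ev-* b φ []            = R.sym (R.zeroʳ b)
  ev-* b φ ((c , d) ∷ p) = begin
    c * (b * φ d) + ev (λ d → b * φ d) p    ≈⟨ R.+-cong (x∙yz≈y∙xz _ _ _) (ev-* b φ p) ⟩
    b * (c * φ d) + b * ev φ p              ≈⟨ R.distribˡ _ _ _ ⟨
    b * (c * φ d + ev φ p)                  ∎

  ev-swap : ∀ {N} (φ : Vec ℕ N → Vec ℕ N → Carrier) p q →
            ev (λ d → ev (φ d) q) p ≈ ev (λ e → ev (λ d → φ d e) p) q
  ev-swap φ []            q = R.sym (ev-zero q)
  ev-swap φ ((b , d) ∷ p) q = begin
    b * ev (φ d) q + ev (λ d → ev (φ d) q) p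
      ≈⟨ R.+-cong (R.sym (ev-* b (φ d) q)) (ev-swap φ p q) ⟩
    ev (λ e → b * φ d e) q + ev (λ e → ev (λ d → φ d e) p) q
      ≈⟨ ev-+ _ _ q ⟨
    ev (λ e → b * φ d e + ev (λ d → φ d e) p) q ∎

  -- A functional of a product is an iterated functional, as in Fubini's theorem. Commutativity and
  -- associativity of the product thus reduce to `ev-swap` and to the laws of `_⊕_`.
  ev-product : ∀ {N} (φ : Vec ℕ N → Carrier) p q →
               ev φ (p P.*ₚ q) ≈ ev (λ d → ev (λ e → φ (d ⊕ e)) q) p
  ev-product φ []            q = R.refl
  ev-product φ ((b , d) ∷ p) q =
    R.trans (ev-++ φ (map (λ (c , e) → b * c , d ⊕ e) q) (p P.*ₚ q))
            (R.+-cong (row q) (ev-product φ p q))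
    where
    row : ∀ q → ev φ (map (λ (c , e) → b * c , d ⊕ e) q) ≈ b * ev (λ e → φ (d ⊕ e)) q
    row []            = R.sym (R.zeroʳ b)
    row ((c , e) ∷ q) = R.trans (R.+-cong (R.*-assoc _ _ _) (row q)) (R.sym (R.distribˡ _ _ _))

  ⊕-comm : ∀ {N} (d e : Vec ℕ N) → d ⊕ e ≡ e ⊕ d
  ⊕-comm = Vec.zipWith-comm ℕ.+-comm

  ⊕-assoc : ∀ {N} (d e f : Vec ℕ N) → (d ⊕ e) ⊕ f ≡ d ⊕ (e ⊕ f)
  ⊕-assoc = Vec.zipWith-assoc ℕ.+-assoc

  ⊕-identityˡ : ∀ {N} (d : Vec ℕ N) → Vec.replicate N 0 ⊕ d ≡ d
  ⊕-identityˡ = Vec.zipWith-identityˡ ℕ.+-identityˡ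

  -- Subtraction is truncated, so `e ⊖ d` is the exponent of a quotient only when `y^d` divides
  -- `y^e`; the equation `d ⊕ (e ⊖ d) ≡ e` tests this.
  _⊖_ : ∀ {N} → Vec ℕ N → Vec ℕ N → Vec ℕ N
  _⊖_ = Vec.zipWith ℕ._∸_

  ⊕-⊖ : ∀ {N} (d e : Vec ℕ N) → (d ⊕ e) ⊖ d ≡ e
  ⊕-⊖ Vec.[]       Vec.[]       = refl
  ⊕-⊖ (k Vec.∷ d) (l Vec.∷ e) = cong₂ Vec._∷_ (ℕ.m+n∸m≡n k l) (⊕-⊖ d e)

  -- The hypothesis `p ≈ₚ q` speaks only of the functionals `δ e`. Shifted by `d`, such a functional
  -- reads off the coefficient at `e ⊖ d` if `y^d` divides `y^e`, and vanishes otherwise.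
  ev-δ-shift-cong : ∀ {N} (d e : Vec ℕ N) p q → p P.≈ₚ q →
                    ev (λ d′ → δ e (d ⊕ d′)) p ≈ ev (λ d′ → δ e (d ⊕ d′)) q
  ev-δ-shift-cong d e p q p≈q with Vec.≡-dec ℕ._≟_ (d ⊕ (e ⊖ d)) e
  ... | yes d∣e = begin
    ev (λ d′ → δ e (d ⊕ d′)) p    ≈⟨ ev-cong p (R.reflexive ∘ shift) ⟩
    ev (δ (e ⊖ d)) p              ≈⟨ coeff≈ev p _ ⟨
    P.coeff p (e ⊖ d)               ≈⟨ p≈q _ ⟩
    P.coeff q (e ⊖ d)               ≈⟨ coeff≈ev q _ ⟩
    ev (δ (e ⊖ d)) q              ≈⟨ ev-cong q (R.reflexive ∘ shift) ⟨
    ev (λ d′ → δ e (d ⊕ d′)) q    ∎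
    where
    shift : ∀ d′ → δ e (d ⊕ d′) ≡ δ (e ⊖ d) d′
    shift d′ = cong (if_then 1# else 0#) (does-⇔
      (mk⇔ (λ { refl → ≡.sym (⊕-⊖ d d′) }) (λ { refl → d∣e }))
      (Vec.≡-dec ℕ._≟_ (d ⊕ d′) e) (Vec.≡-dec ℕ._≟_ d′ (e ⊖ d)))
  ... | no d∤e = R.trans (ev-cong p vanish) (R.trans (ev-zero p)
                   (R.sym (R.trans (ev-cong q vanish) (ev-zero q))))
    where
    vanish : ∀ d′ → δ e (d ⊕ d′) ≈ 0#
    vanish d′ = R.reflexive (cong (if_then 1# else 0#)
      (dec-false (Vec.≡-dec ℕ._≟_ (d ⊕ d′) e) λ { refl → d∤e (cong (d ⊕_) (⊕-⊖ d d′)) }))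

  ev⇒≈ₚ : ∀ {N} (p q : P.Poly N) → (∀ φ → ev φ p ≈ ev φ q) → p P.≈ₚ q
  ev⇒≈ₚ p q h e = R.trans (coeff≈ev p e) (R.trans (h (δ e)) (R.sym (coeff≈ev q e)))

  *ₚ-congˡ : ∀ {N} (p q r : P.Poly N) → q P.≈ₚ r → p P.*ₚ q P.≈ₚ p P.*ₚ r
  *ₚ-congˡ p q r q≈r e = begin
    P.coeff (p P.*ₚ q) e                          ≈⟨ coeff≈ev (p P.*ₚ q) e ⟩
    ev (δ e) (p P.*ₚ q)                         ≈⟨ ev-product (δ e) p q ⟩
    ev (λ d → ev (λ d′ → δ e (d ⊕ d′)) q) p     ≈⟨ ev-cong p (λ d → ev-δ-shift-cong d e q r q≈r) ⟩
    ev (λ d → ev (λ d′ → δ e (d ⊕ d′)) r) p     ≈⟨ ev-product (δ e) p r ⟨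
    ev (δ e) (p P.*ₚ r)                         ≈⟨ coeff≈ev (p P.*ₚ r) e ⟨
    P.coeff (p P.*ₚ r) e                          ∎

  *ₚ-comm : ∀ {N} (p q : P.Poly N) → p P.*ₚ q P.≈ₚ q P.*ₚ p
  *ₚ-comm p q = ev⇒≈ₚ (p P.*ₚ q) (q P.*ₚ p) λ φ → begin
    ev φ (p P.*ₚ q)                         ≈⟨ ev-product φ p q ⟩
    ev (λ d → ev (λ e → φ (d ⊕ e)) q) p     ≈⟨ ev-swap (λ d e → φ (d ⊕ e)) p q ⟩
    ev (λ e → ev (λ d → φ (d ⊕ e)) p) q     ≈⟨ ev-cong q (λ e → ev-cong p λ d → R.reflexive (cong φ (⊕-comm d e))) ⟩
    ev (λ e → ev (λ d → φ (e ⊕ d)) p) q     ≈⟨ ev-product φ q p ⟨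
    ev φ (q P.*ₚ p)                         ∎

  *ₚ-assoc : ∀ {N} (p q r : P.Poly N) → (p P.*ₚ q) P.*ₚ r P.≈ₚ p P.*ₚ (q P.*ₚ r)
  *ₚ-assoc p q r = ev⇒≈ₚ ((p P.*ₚ q) P.*ₚ r) (p P.*ₚ (q P.*ₚ r)) λ φ → begin
    ev φ ((p P.*ₚ q) P.*ₚ r)
      ≈⟨ ev-product φ (p P.*ₚ q) r ⟩
    ev (λ d → ev (λ f → φ (d ⊕ f)) r) (p P.*ₚ q)
      ≈⟨ ev-product _ p q ⟩
    ev (λ d → ev (λ e → ev (λ f → φ ((d ⊕ e) ⊕ f)) r) q) p
      ≈⟨ ev-cong p (λ d → ev-cong q λ e → ev-cong r λ f → R.reflexive (cong φ (⊕-assoc d e f))) ⟩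
    ev (λ d → ev (λ e → ev (λ f → φ (d ⊕ (e ⊕ f))) r) q) p
      ≈⟨ ev-cong p (λ d → ev-product (λ e → φ (d ⊕ e)) q r) ⟨
    ev (λ d → ev (λ e → φ (d ⊕ e)) (q P.*ₚ r)) p
      ≈⟨ ev-product φ p (q P.*ₚ r) ⟨
    ev φ (p P.*ₚ (q P.*ₚ r)) ∎

  *ₚ-cong : ∀ {N} (p q r s : P.Poly N) → p P.≈ₚ q → r P.≈ₚ s → p P.*ₚ r P.≈ₚ q P.*ₚ s
  *ₚ-cong p q r s p≈q r≈s e = begin
    P.coeff (p P.*ₚ r) e    ≈⟨ *ₚ-congˡ p r s r≈s e ⟩
    P.coeff (p P.*ₚ s) e    ≈⟨ *ₚ-comm p s e ⟩
    P.coeff (s P.*ₚ p) e    ≈⟨ *ₚ-congˡ s p q p≈q e ⟩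
    P.coeff (s P.*ₚ q) e    ≈⟨ *ₚ-comm s q e ⟩
    P.coeff (q P.*ₚ s) e    ∎

  ev-const-* : ∀ {N} b (φ : Vec ℕ N → Carrier) p → ev φ (P.const b P.*ₚ p) ≈ b * ev φ p
  ev-const-* {N} b φ p = begin
    ev φ (P.const b P.*ₚ p)                             ≈⟨ ev-product φ (P.const b) p ⟩
    b * ev (λ e → φ (Vec.replicate N 0 ⊕ e)) p + 0#     ≈⟨ R.+-identityʳ _ ⟩
    b * ev (λ e → φ (Vec.replicate N 0 ⊕ e)) p          ≈⟨ R.*-congˡ (ev-cong p λ e → R.reflexive (cong φ (⊕-identityˡ e))) ⟩
    b * ev φ p                                          ∎

  *ₚ-identityˡ : ∀ {N} (p : P.Poly N) → P.1ₚ P.*ₚ p P.≈ₚ p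
  *ₚ-identityˡ p = ev⇒≈ₚ (P.1ₚ P.*ₚ p) p λ φ → R.trans (ev-const-* 1# φ p) (R.*-identityˡ _)

  *ₚ-distribʳ-+ₚ : ∀ {N} (p q r : P.Poly N) → (q P.+ₚ r) P.*ₚ p P.≈ₚ q P.*ₚ p P.+ₚ r P.*ₚ p
  *ₚ-distribʳ-+ₚ p q r = ev⇒≈ₚ ((q P.+ₚ r) P.*ₚ p) (q P.*ₚ p P.+ₚ r P.*ₚ p) λ φ → begin
    ev φ ((q P.+ₚ r) P.*ₚ p)                    ≈⟨ ev-product φ (q P.+ₚ r) p ⟩
    ev (λ d → ev (λ e → φ (d ⊕ e)) p) (q ++ r)  ≈⟨ ev-++ _ q r ⟩
    _                                           ≈⟨ R.+-cong (ev-product φ q p) (ev-product φ r p) ⟨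
    ev φ (q P.*ₚ p) + ev φ (r P.*ₚ p)           ≈⟨ ev-++ φ (q P.*ₚ p) (r P.*ₚ p) ⟨
    ev φ (q P.*ₚ p P.+ₚ r P.*ₚ p)               ∎

  +ₚ-comm : ∀ {N} (p q : P.Poly N) → p P.+ₚ q P.≈ₚ q P.+ₚ p
  +ₚ-comm p q = ev⇒≈ₚ (p ++ q) (q ++ p) λ φ →
    R.trans (ev-++ φ p q) (R.trans (R.+-comm _ _) (R.sym (ev-++ φ q p)))

  coeff-++ : ∀ {N} (p q : P.Poly N) e → P.coeff (p ++ q) e ≈ P.coeff p e + P.coeff q e
  coeff-++ p q e = begin
    P.coeff (p ++ q) e           ≈⟨ coeff≈ev (p ++ q) e ⟩
    ev (δ e) (p ++ q)          ≈⟨ ev-++ (δ e) p q ⟩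
    ev (δ e) p + ev (δ e) q    ≈⟨ R.+-cong (coeff≈ev p e) (coeff≈ev q e) ⟨
    P.coeff p e + P.coeff q e      ∎

  +ₚ-cong : ∀ {N} (p q r s : P.Poly N) → p P.≈ₚ q → r P.≈ₚ s → p P.+ₚ r P.≈ₚ q P.+ₚ s
  +ₚ-cong p q r s p≈q r≈s e = R.trans (coeff-++ p r e)
    (R.trans (R.+-cong (p≈q e) (r≈s e)) (R.sym (coeff-++ q s e)))

  -- Chosen so that subtraction in the ring unfolds to `_-ₚ_`; `x+[1-x]≈1` then applies directly to
  -- a variable and its complement.
  -ₚ_ : ∀ {N} → P.Poly N → P.Poly N
  -ₚ p = P.const (- 1#) P.*ₚ p

  -ₚ-inverseʳ : ∀ {N} (p : P.Poly N) → p P.+ₚ (-ₚ p) P.≈ₚ P.0ₚ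
  -ₚ-inverseʳ p = ev⇒≈ₚ (p P.+ₚ (-ₚ p)) P.0ₚ λ φ → begin
    ev φ (p ++ (-ₚ p))          ≈⟨ ev-++ φ p (-ₚ p) ⟩
    ev φ p + ev φ (-ₚ p)        ≈⟨ R.+-congˡ (ev-const-* (- 1#) φ p) ⟩
    ev φ p + - 1# * ev φ p      ≈⟨ R.+-congˡ (-1*x≈-x _) ⟩
    ev φ p + - ev φ p           ≈⟨ R.-‿inverseʳ _ ⟩
    0#                          ∎

  polynomialRing : ℕ → CommutativeRing c ℓ
  polynomialRing N = record
    { Carrier = P.Poly N ; _≈_ = P._≈ₚ_ ; _+_ = P._+ₚ_ ; _*_ = P._*ₚ_ ; -_ = -ₚ_ ; 0# = P.0ₚ ; 1# = P.1ₚ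
    ; isCommutativeRing = record
      { isRing = record
        { +-isAbelianGroup = record
          { isGroup = record
            { isMonoid = record
              { isSemigroup = record
                { isMagma = record
                  { isEquivalence = record
                    { refl  = λ e → R.refl
                    ; sym   = λ p≈q e → R.sym (p≈q e)
                    ; trans = λ p≈q q≈r e → R.trans (p≈q e) (q≈r e)
                    }
                  ; ∙-cong = λ {p} {q} {r} {s} → +ₚ-cong p q r s
                  }
                ; assoc = λ p q r e → R.reflexive (cong (λ s → P.coeff s e) (List.++-assoc p q r))
                }
              ; identity = (λ p e → R.refl)
                         , (λ p e → R.reflexive (cong (λ s → P.coeff s e) (List.++-identityʳ p)))
              }
            ; inverse = (λ p e → R.trans (+ₚ-comm (-ₚ p) p e) (-ₚ-inverseʳ p e)) , -ₚ-inverseʳ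
            ; ⁻¹-cong = λ {p} {q} → *ₚ-congˡ (P.const (- 1#)) p q
            }
          ; comm = +ₚ-comm
          }
        ; *-cong = λ {p} {q} {r} {s} → *ₚ-cong p q r s
        ; *-assoc = *ₚ-assoc
        ; *-identity = *ₚ-identityˡ , (λ p e → R.trans (*ₚ-comm p P.1ₚ e) (*ₚ-identityˡ p e))
        ; distrib = (λ p q r e → R.trans (*ₚ-comm p (q ++ r) e)
                       (R.trans (*ₚ-distribʳ-+ₚ p q r e)
                         (+ₚ-cong (q P.*ₚ p) (p P.*ₚ q) (r P.*ₚ p) (p P.*ₚ r)
                           (*ₚ-comm q p) (*ₚ-comm r p) e)))
                  , *ₚ-distribʳ-+ₚ
        }
      ; *-comm = *ₚ-comm
      }
    }
    where import Data.List.Properties as List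

-- Sums and products over lists

module ListFold {c ℓ} (M : CommutativeMonoid c ℓ) where
  open CommutativeMonoid M renaming (refl to ≈-refl)
  open import Algebra.Properties.CommutativeSemigroup commutativeSemigroup
    using (interchange; x∙yz≈y∙xz)

  -- In this form `∑ₚ`, `∏ₚ`, `∑ℝ` and `sum` of a mapped list are all instances by definition.
  fold : (A → Carrier) → List A → Carrier
  fold f xs = foldr _∙_ ε (map f xs)

  fold-++ : ∀ (f : A → Carrier) xs ys → fold f (xs ++ ys) ≈ fold f xs ∙ fold f ys
  fold-++ f []       ys = sym (identityˡ _)
  fold-++ f (x ∷ xs) ys = trans (∙-congˡ (fold-++ f xs ys)) (sym (assoc _ _ _))

  fold-map : ∀ (f : B → Carrier) (g : A → B) xs → fold f (map g xs) ≈ fold (f ∘ g) xs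
  fold-map f g xs = reflexive (cong (foldr _∙_ ε) (≡.sym (List.map-∘ xs)))

  fold-cong : ∀ {f g : A → Carrier} {xs} → All (λ x → f x ≈ g x) xs → fold f xs ≈ fold g xs
  fold-cong []         = ≈-refl
  fold-cong (eq ∷ eqs) = ∙-cong eq (fold-cong eqs)

  fold-∙ : ∀ (f g : A → Carrier) xs → fold (λ x → f x ∙ g x) xs ≈ fold f xs ∙ fold g xs
  fold-∙ f g []       = sym (identityˡ ε)
  fold-∙ f g (x ∷ xs) = trans (∙-congˡ (fold-∙ f g xs)) (interchange _ _ _ _)

  fold-ε : ∀ (xs : List A) → fold (λ _ → ε) xs ≈ ε
  fold-ε []       = ≈-refl
  fold-ε (x ∷ xs) = trans (identityˡ _) (fold-ε xs)

  fold-filter : ∀ {p} {P : A → Set p} (P? : Decidable P) (f : A → Carrier) xs →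
                fold f (filter P? xs) ≈ fold (λ x → if does (P? x) then f x else ε) xs
  fold-filter P? f []       = ≈-refl
  fold-filter P? f (x ∷ xs) with does (P? x)
  ... | true  = ∙-congˡ (fold-filter P? f xs)
  ... | false = trans (fold-filter P? f xs) (sym (identityˡ _))

  fold-update : ∀ {f g : A → Carrier} {z : A} {u} {xs} → Unique xs → z ∈ xs →
                (∀ x → x ≢ z → f x ≈ g x) → f z ≈ u ∙ g z → fold f xs ≈ u ∙ fold g xs
  fold-update (z∉xs ∷ _) (here refl) f≈g fz≈ =
    trans (∙-cong fz≈ (fold-cong (All.map (λ z≢x → f≈g _ (z≢x ∘ ≡.sym)) z∉xs))) (assoc _ _ _)
  fold-update (y∉xs ∷ xs!) (there z∈xs) f≈g fz≈ =
    trans (∙-cong (f≈g _ (All.lookup y∉xs z∈xs)) (fold-update xs! z∈xs f≈g fz≈)) (x∙yz≈y∙xz _ _ _)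

  -- Induction on `xs`: a new `x` changes only the fibre over `t x`, and `fold-update` extracts its
  -- factor. With axioms as fibres this regroups the polynomial sum, the number of terms and the sum
  -- of coefficients.
  fold-fibres : (_≟_ : DecidableEquality B) (t : A → B) (f : A → Carrier) {ls : List B} →
                Unique ls → ∀ {xs} → All (λ x → t x ∈ ls) xs →
                fold (λ l → fold f (filter (λ x → t x ≟ l) xs)) ls ≈ fold f xs
  fold-fibres _≟_ t f {ls} ls! []               = fold-ε ls
  fold-fibres _≟_ t f {ls} ls! {x ∷ xs} (tx∈ ∷ txs∈) =
    trans (fold-update ls! tx∈ off on) (∙-congˡ (fold-fibres _≟_ t f ls! txs∈))
    where
    off : ∀ l → l ≢ t x → fold f (filter (λ y → t y ≟ l) (x ∷ xs)) ≈ fold f (filter (λ y → t y ≟ l) xs)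
    off l l≢tx with t x ≟ l
    ... | yes tx≡l with () ← l≢tx (≡.sym tx≡l)
    ... | no _ = ≈-refl
    on : fold f (filter (λ y → t y ≟ t x) (x ∷ xs)) ≈ f x ∙ fold f (filter (λ y → t y ≟ t x) xs)
    on with t x ≟ t x
    ... | yes _ = ≈-refl
    ... | no tx≢tx with () ← tx≢tx refl

-- Ring identities behind a single match

module RingIdentities {c ℓ} (R : CommutativeRing c ℓ) where
  open CommutativeRing R renaming (refl to ≈-refl)
  open import Algebra.Solver.Ring.NaturalCoefficients.Default commutativeSemiring
  open import Relation.Binary.Reasoning.Setoid setoid
  open ListFold +-commutativeMonoid

  fold-*ˡ : ∀ u (f : A → Carrier) xs → fold (λ x → u * f x) xs ≈ u * fold f xs
  fold-*ˡ u f []       = sym (zeroʳ u)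
  fold-*ˡ u f (x ∷ xs) = trans (+-congˡ (fold-*ˡ u f xs)) (sym (distribˡ _ _ _))

  x+[1-x]≈1 : ∀ u → u + (1# - u) ≈ 1#
  x+[1-x]≈1 u = begin
    u + (1# - u)        ≈⟨ +-congˡ (+-comm 1# (- u)) ⟩
    u + (- u + 1#)      ≈⟨ +-assoc u (- u) 1# ⟨
    (u - u) + 1#        ≈⟨ +-congʳ (-‿inverseʳ u) ⟩
    0# + 1#             ≈⟨ +-identityˡ 1# ⟩
    1#                  ∎

  -- With a = x i w, b = x i v, c = x w v and primes for complements: if i
  -- beats the winner of the match between w and v, then either i beats
  -- both or the three form one of the two cycles.
  match-split : ∀ a a′ b b′ c c′ s → a + a′ ≈ 1# → b + b′ ≈ 1# → c + c′ ≈ 1# →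
                (c * s) * a + (c′ * s) * b ≈
                s * (a * b) + ((c * b′ * a) * s + (b * c′ * a′) * s)
  match-split a a′ b b′ c c′ s a+a′ b+b′ c+c′ = begin
    (c * s) * a + (c′ * s) * b
      ≈⟨ +-cong (*-identityʳ _) (*-identityʳ _) ⟨
    (c * s) * a * 1# + (c′ * s) * b * 1#
      -- In each branch the unit splits on the match of i against the loser; the two products
      -- containing `a * b` then merge by `c + c′ ≈ 1#`.
      ≈⟨ +-cong (*-congˡ b+b′) (*-congˡ a+a′) ⟨
    (c * s) * a * (b + b′) + (c′ * s) * b * (a + a′)
      ≈⟨ solve 7 (λ a a′ b b′ c c′ s →
           (c :* s) :* a :* (b :+ b′) :+ (c′ :* s) :* b :* (a :+ a′) :=
           (c :+ c′) :* (s :* (a :* b)) :+ ((c :* b′ :* a) :* s :+ (b :* c′ :* a′) :* s))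
           ≈-refl a a′ b b′ c c′ s ⟩
    (c + c′) * (s * (a * b)) + ((c * b′ * a) * s + (b * c′ * a′) * s)
      ≈⟨ +-congʳ (trans (*-congʳ c+c′) (*-identityˡ _)) ⟩
    s * (a * b) + ((c * b′ * a) * s + (b * c′ * a′) * s) ∎

-- Partial tournaments

-- The pairs with smaller element `zero` fill the first block of indices, and `splitAt` tells this
-- block from the rest.
pairIndex-injective : ∀ {n} {i j k l : Fin n} (i<j : i Fin.< j) (k<l : k Fin.< l) →
                      pairIndex i j i<j ≡ pairIndex k l k<l → i ≡ k × j ≡ l
pairIndex-injective {suc n} {zero}  {suc j} {zero}  {suc l} _ _ eq =
  refl , cong suc (Fin.↑ˡ-injective _ j l eq)
pairIndex-injective {suc n} {zero}  {suc j} {suc k} {suc l} _ (s<s k<l) eq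
  with () ← ≡.trans (≡.sym (Fin.splitAt-↑ˡ n j _))
    (≡.trans (cong (Fin.splitAt n) eq) (Fin.splitAt-↑ʳ n _ (pairIndex k l k<l)))
pairIndex-injective {suc n} {suc i} {suc j} {zero}  {suc l} (s<s i<j) _ eq
  with () ← ≡.trans (≡.sym (Fin.splitAt-↑ˡ n l _))
    (≡.trans (cong (Fin.splitAt n) (≡.sym eq)) (Fin.splitAt-↑ʳ n _ (pairIndex i j i<j)))
pairIndex-injective {suc n} {suc i} {suc j} {suc k} {suc l} (s<s i<j) (s<s k<l) eq
  with i≡k , j≡l ← pairIndex-injective i<j k<l (Fin.↑ʳ-injective n _ _ eq) =
  cong suc i≡k , cong suc j≡l

Comparison : ∀ {n} → Fin n → Fin n → Set
Comparison i j = Tri (i Fin.< j) (i ≡ j) (j Fin.< i)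

module Tournament (n : ℕ) where
  open ≡ using (sym; trans)

  -- Represents a monomial: the entry at the pair i < j is `just true` if it
  -- contains x i j, and `just false` if it contains x j i.
  Partial : Set
  Partial = Vec (Maybe Bool) (numPairs n)

  undecided : Partial
  undecided = Vec.replicate _ nothing

  -- The comparison is an explicit argument so that `mono-orient` can split on it without
  -- abstracting over polynomials.
  orientAt : (i j : Fin n) → Comparison i j → Partial → Partial
  orientAt i j (tri< i<j _ _) ρ = ρ [ pairIndex i j i<j ]≔ just true
  orientAt i j (tri≈ _ _ _)   ρ = ρ
  orientAt i j (tri> _ _ j<i) ρ = ρ [ pairIndex j i j<i ]≔ just false

  orient : Fin n → Fin n → Partial → Partial
  orient i j = orientAt i j (Fin.<-cmp i j)

  FreeAt : Partial → (i j : Fin n) → Comparison i j → Set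
  FreeAt ρ i j (tri< i<j _ _) = lookup ρ (pairIndex i j i<j) ≡ nothing
  -- The diagonal counts as free, so that `FreeOn` can range over all pairs from a list.
  FreeAt ρ i j (tri≈ _ _ _)   = ⊤
  FreeAt ρ i j (tri> _ _ j<i) = lookup ρ (pairIndex j i j<i) ≡ nothing

  Free : Partial → Fin n → Fin n → Set
  Free ρ i j = FreeAt ρ i j (Fin.<-cmp i j)

  -- Invariant of the recursion: no match among the champion and the elements still to come is
  -- decided. Orienting such a pair multiplies the monomial by a literal instead of overwriting one.
  FreeOn : Partial → List (Fin n) → Set
  FreeOn ρ L = ∀ {k l} → k ∈ L → l ∈ L → Free ρ k l

  undecided-free : ∀ (i j : Fin n) → Free undecided i j
  undecided-free i j with Fin.<-cmp i j
  ... | tri< i<j _ _ = Vec.lookup-replicate (pairIndex i j i<j) nothing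
  ... | tri≈ _ _ _   = _
  ... | tri> _ _ j<i = Vec.lookup-replicate (pairIndex j i j<i) nothing

  -- Only the loser `j` has to differ from `k` and `l`: the pair of `i` and `j` is then another
  -- pair, even if the winner `i` stays in play.
  orient-free : ∀ (ρ : Partial) i {j k l} → j ≢ k → j ≢ l → Free ρ k l → Free (orient i j ρ) k l
  orient-free ρ i {j} {k} {l} j≢k j≢l free with Fin.<-cmp k l | Fin.<-cmp i j
  ... | tri≈ _ _ _   | _            = _
  ... | tri< _ _ _   | tri≈ _ _ _   = free
  ... | tri> _ _ _   | tri≈ _ _ _   = free
  ... | tri< k<l _ _ | tri< i<j _ _ =
    trans (Vec.lookup∘update′ (λ eq → j≢l (sym (proj₂ (pairIndex-injective k<l i<j eq)))) ρ _) free
  ... | tri< k<l _ _ | tri> _ _ j<i =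
    trans (Vec.lookup∘update′ (λ eq → j≢k (sym (proj₁ (pairIndex-injective k<l j<i eq)))) ρ _) free
  ... | tri> _ _ l<k | tri< i<j _ _ =
    trans (Vec.lookup∘update′ (λ eq → j≢k (sym (proj₂ (pairIndex-injective l<k i<j eq)))) ρ _) free
  ... | tri> _ _ l<k | tri> _ _ j<i =
    trans (Vec.lookup∘update′ (λ eq → j≢l (sym (proj₁ (pairIndex-injective l<k j<i eq)))) ρ _) free

  infix 4 _⊑_

  -- Divisibility of the represented monomials.
  _⊑_ : ∀ {N} → Vec (Maybe Bool) N → Vec (Maybe Bool) N → Set
  ρ ⊑ σ = ∀ a b → lookup ρ a ≡ just b → lookup σ a ≡ just b

  update-⊑ : ∀ {N} (ρ : Vec (Maybe Bool) N) a {c} → lookup ρ a ≡ nothing → ρ ⊑ ρ [ a ]≔ c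
  update-⊑ ρ a unset a′ _ set with a′ Fin.≟ a
  ... | yes refl with () ← trans (sym unset) set
  ... | no a′≢a = trans (Vec.lookup∘update′ a′≢a ρ _) set

  orient-⊑ : ∀ (ρ : Partial) i j → Free ρ i j → ρ ⊑ orient i j ρ
  orient-⊑ ρ i j free with Fin.<-cmp i j
  ... | tri< i<j _ _ = update-⊑ ρ (pairIndex i j i<j) free
  ... | tri≈ _ _ _   = λ _ _ set → set
  ... | tri> _ _ j<i = update-⊑ ρ (pairIndex j i j<i) free

  orient-< : ∀ (ρ : Partial) {i j} (i<j : i Fin.< j) →
             lookup (orient i j ρ) (pairIndex i j i<j) ≡ just true
  orient-< ρ {i} {j} i<j with Fin.<-cmp i j
  ... | tri< i<j′ _ _ rewrite ℕ.<-irrelevant i<j′ i<j = Vec.lookup∘update (pairIndex i j i<j) ρ _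
  ... | tri≈ i≮j _ _ with () ← i≮j i<j
  ... | tri> i≮j _ _ with () ← i≮j i<j

  orient-> : ∀ (ρ : Partial) {i j} (j<i : j Fin.< i) →
             lookup (orient i j ρ) (pairIndex j i j<i) ≡ just false
  orient-> ρ {i} {j} j<i with Fin.<-cmp i j
  ... | tri< _ _ j≮i with () ← j≮i j<i
  ... | tri≈ _ _ j≮i with () ← j≮i j<i
  ... | tri> _ _ j<i′ rewrite ℕ.<-irrelevant j<i′ j<i = Vec.lookup∘update (pairIndex j i j<i) ρ _

  orientAll : Fin n → List (Fin n) → Partial → Partial
  orientAll i js ρ = foldr (orient i) ρ js

  orientAll-free : ∀ (ρ : Partial) i {j js} → All (i ≢_) js → All (j ≢_) js →
                   Free ρ i j → Free (orientAll i js ρ) i j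
  orientAll-free ρ i []            []            free = free
  orientAll-free ρ i (i≢k ∷ i∉js) (j≢k ∷ j∉js) free =
    orient-free _ i (i≢k ∘ sym) (j≢k ∘ sym) (orientAll-free ρ i i∉js j∉js free)

  orientAll-⊑ : ∀ (ρ : Partial) i {js} → All (i ≢_) js → Unique js →
                All (Free ρ i) js → ρ ⊑ orientAll i js ρ
  orientAll-⊑ ρ i []            []           []            a b set = set
  orientAll-⊑ ρ i {j ∷ js} (_ ∷ i∉js) (j∉js ∷ js!) (free ∷ frees) a b set =
    orient-⊑ (orientAll i js ρ) i j (orientAll-free ρ i i∉js j∉js free) a b
      (orientAll-⊑ ρ i i∉js js! frees a b set)

  -- The same filter as in `nonMinimality`, so that `star i (allFin n)` is that axiom by definition.
  others : Fin n → List (Fin n) → List (Fin n)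
  others i = filter (λ j → ¬? (j Fin.≟ i))

  others-self : ∀ {w : Fin n} {R} → All (w ≢_) R → others w (w ∷ R) ≡ R
  others-self {w = w} {R} w∉R = trans
    (List.filter-reject (λ j → ¬? (j Fin.≟ w)) (λ w≢w → w≢w refl))
    (List.filter-all (λ j → ¬? (j Fin.≟ w)) (All.map (_∘ sym) w∉R))

  others-∷ : ∀ {i w : Fin n} {R} → w ≢ i → others i (w ∷ R) ≡ w ∷ others i R
  others-∷ {i = i} = List.filter-accept (λ j → ¬? (j Fin.≟ i))

  others-≢ : ∀ (i : Fin n) R → All (i ≢_) (others i R)
  others-≢ i R = All.map (_∘ sym) (All.all-filter (λ j → ¬? (j Fin.≟ i)) R)

  others-free : ∀ {ρ : Partial} {i R} → FreeOn ρ R → i ∈ R → All (Free ρ i) (others i R)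
  others-free free i∈R = All.tabulate (free i∈R ∘ proj₁ ∘ ∈-filter⁻ _)

  -- Names for the axioms

  Triple : Set
  Triple = Fin n × Fin n × Fin n

  -- A `source` names a non-minimality axiom; `cycle₁` and `cycle₂` name the two cyclic orientations
  -- of a triangle, that is, the two kinds of transitivity axiom.
  Label : Set
  Label = Fin n ⊎ (Triple ⊎ Triple)

  pattern source i = inj₁ i
  pattern cycle₁ t = inj₂ (inj₁ t)
  pattern cycle₂ t = inj₂ (inj₂ t)

  infix 4 _≟ₗ_

  _≟ₗ_ : DecidableEquality Label
  _≟ₗ_ = Sum.≡-dec Fin._≟_ (Sum.≡-dec _≟ₜ_ _≟ₜ_)
    where
    _≟ₜ_ : DecidableEquality Triple
    _≟ₜ_ = Product.≡-dec Fin._≟_ (Product.≡-dec Fin._≟_ Fin._≟_)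

  -- Listed in the order of `ordAxioms`, as `ordAxioms≡` requires.
  labels : List Label
  labels = map source (allFin n) ++ map cycle₁ (increasingTriples n) ++ map cycle₂ (increasingTriples n)

  increasingTriples-unique : Unique (increasingTriples n)
  increasingTriples-unique = Unique.filter⁺ _
    (Unique.cartesianProduct⁺ (Unique.allFin⁺ n) (Unique.cartesianProduct⁺ (Unique.allFin⁺ n) (Unique.allFin⁺ n)))

  increasingTriples-complete : ∀ {i j k} → i Fin.< j → j Fin.< k → (i , j , k) ∈ increasingTriples n
  increasingTriples-complete i<j j<k = ∈-filter⁺ _
    (∈-cartesianProduct⁺ (∈-allFin _) (∈-cartesianProduct⁺ (∈-allFin _) (∈-allFin _))) (i<j , j<k)

  labels-unique : Unique labels
  labels-unique = Unique.++⁺ (Unique.map⁺ (λ { refl → refl }) (Unique.allFin⁺ n))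
    (Unique.++⁺ (Unique.map⁺ (λ { refl → refl }) increasingTriples-unique)
                (Unique.map⁺ (λ { refl → refl }) increasingTriples-unique) cycles-disjoint)
    sources-disjoint
    where
    cycles-disjoint : Disjoint (map cycle₁ (increasingTriples n)) (map cycle₂ (increasingTriples n))
    cycles-disjoint (p , q) with _ , _ , refl ← ∈-map⁻ _ p | _ , _ , () ← ∈-map⁻ _ q
    sources-disjoint : Disjoint (map source (allFin n)) (map cycle₁ (increasingTriples n) ++ map cycle₂ (increasingTriples n))
    sources-disjoint (p , q) with _ , _ , refl ← ∈-map⁻ _ p
      | ∈-++⁻ (map cycle₁ (increasingTriples n)) q
    ... | inj₁ q′ with _ , _ , () ← ∈-map⁻ _ q′
    ... | inj₂ q′ with _ , _ , () ← ∈-map⁻ _ q′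

  -- The error terms of one match: for each `i` in `R`, both cycles on `w`, `v`, `i`, weakened by
  -- the outcomes in `ρ` and by `i` beating the rest of `R`. The three pairs of the triangle belong
  -- to the axiom and stay out of the weakening.
  matchCycles₁ matchCycles₂ matchCycles : Partial → Fin n → Fin n → List (Fin n) → List (Label × Partial)
  matchCycles₁ ρ w v R = map (λ i → cycle₁ (w , v , i) , orientAll i (others i R) ρ) R
  matchCycles₂ ρ w v R = map (λ i → cycle₂ (w , v , i) , orientAll i (others i R) ρ) R
  matchCycles  ρ w v R = matchCycles₁ ρ w v R ++ matchCycles₂ ρ w v R

  cycles : Partial → Fin n → List (Fin n) → List (Label × Partial)
  cycles ρ w []      = []
  cycles ρ w (v ∷ R) = cycles (orient w v ρ) w R ++ cycles (orient v w ρ) v R ++ matchCycles ρ w v R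

  -- Challengers enter in increasing order, so champion, challenger and any later element form an
  -- increasing triple, as the transitivity axioms demand.
  Increasing : List (Fin n) → Set
  Increasing = AllPairs Fin._<_

  increasing⇒unique : ∀ {L : List (Fin n)} → Increasing L → Unique L
  increasing⇒unique = AllPairs.map Fin.<⇒≢

  freeOn-orient : ∀ {ρ : Partial} {L} i {j} → All (j ≢_) L → FreeOn ρ L → FreeOn (orient i j ρ) L
  freeOn-orient i j∉L free k∈L l∈L =
    orient-free _ i (All.lookup j∉L k∈L) (All.lookup j∉L l∈L) (free k∈L l∈L)

  module Match {ρ : Partial} {w v : Fin n} {R : List (Fin n)}
               (incr : Increasing (w ∷ v ∷ R)) (free : FreeOn ρ (w ∷ v ∷ R)) where

    w<v : w Fin.< v
    w<v = All.head (AllPairs.head incr)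

    w≢v : w ≢ v
    w≢v = Fin.<⇒≢ w<v

    w<R : All (w Fin.<_) R
    w<R = All.tail (AllPairs.head incr)

    v<R : All (v Fin.<_) R
    v<R = AllPairs.head (AllPairs.tail incr)

    w∉R : All (w ≢_) R
    w∉R = All.map Fin.<⇒≢ w<R

    v∉R : All (v ≢_) R
    v∉R = All.map Fin.<⇒≢ v<R

    R-increasing : Increasing R
    R-increasing = AllPairs.tail (AllPairs.tail incr)

    w-increasing : Increasing (w ∷ R)
    w-increasing = w<R ∷ R-increasing

    v-increasing : Increasing (v ∷ R)
    v-increasing = AllPairs.tail incr

    w-free : FreeOn (orient w v ρ) (w ∷ R)
    w-free = freeOn-orient w ((w≢v ∘ sym) ∷ v∉R) λ k∈ l∈ → free (weaken k∈) (weaken l∈)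
      where
      weaken : ∀ {k} → k ∈ w ∷ R → k ∈ w ∷ v ∷ R
      weaken (here eq)  = here eq
      weaken (there k∈) = there (there k∈)

    v-free : FreeOn (orient v w ρ) (v ∷ R)
    v-free = freeOn-orient v (w≢v ∷ w∉R) λ k∈ l∈ → free (there k∈) (there l∈)

    R-free : FreeOn ρ R
    R-free k∈ l∈ = free (there (there k∈)) (there (there l∈))

    free-wv : Free ρ w v
    free-wv = free (here refl) (there (here refl))

    free-vw : Free ρ v w
    free-vw = free (there (here refl)) (here refl)

    others-unique : ∀ i → Unique (others i R)
    others-unique i = Unique.filter⁺ _ (increasing⇒unique R-increasing)

  -- The solved recurrence, stated additively to avoid truncated subtraction.
  cycles-length : ∀ ρ w R → length (cycles ρ w R) ℕ.+ 2 ℕ.* suc (length R) ≡ 2 ^ suc (length R)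
  cycles-length ρ w []      = refl
  cycles-length ρ w (v ∷ R) = begin
    length (C₁ ++ C₂ ++ matchCycles ρ w v R) ℕ.+ 2 ℕ.* suc (suc r)
      ≡⟨ cong (ℕ._+ 2 ℕ.* suc (suc r)) lengths ⟩
    length C₁ ℕ.+ (length C₂ ℕ.+ (r ℕ.+ r)) ℕ.+ 2 ℕ.* suc (suc r)
      ≡⟨ arithmetic (length C₁) (length C₂) r ⟩
    -- The trailing 0 is how `2 * k` unfolds, so that the last step lands on `2 ^ suc (suc r)` by
    -- definition.
    (length C₁ ℕ.+ 2 ℕ.* suc r) ℕ.+ ((length C₂ ℕ.+ 2 ℕ.* suc r) ℕ.+ 0)
      ≡⟨ cong₂ (λ a b → a ℕ.+ (b ℕ.+ 0)) (cycles-length _ w R) (cycles-length _ v R) ⟩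
    2 ^ suc (suc r) ∎
    where
    open ≡.≡-Reasoning
    r = length R
    C₁ = cycles (orient w v ρ) w R
    C₂ = cycles (orient v w ρ) v R
    lengths : length (C₁ ++ C₂ ++ matchCycles ρ w v R) ≡ length C₁ ℕ.+ (length C₂ ℕ.+ (r ℕ.+ r))
    lengths = trans (List.length-++ C₁) (cong (length C₁ ℕ.+_)
      (trans (List.length-++ C₂) (cong (length C₂ ℕ.+_)
        (trans (List.length-++ (matchCycles₁ ρ w v R)) (cong₂ ℕ._+_ (List.length-map _ R) (List.length-map _ R))))))
    arithmetic : ∀ a b r → a ℕ.+ (b ℕ.+ (r ℕ.+ r)) ℕ.+ 2 ℕ.* suc (suc r) ≡ (a ℕ.+ 2 ℕ.* suc r) ℕ.+ ((b ℕ.+ 2 ℕ.* suc r) ℕ.+ 0)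
    arithmetic = solve-∀

  cycles-labels : ∀ (ρ : Partial) w R → Increasing (w ∷ R) → All (λ e → proj₁ e ∈ labels) (cycles ρ w R)
  cycles-labels ρ w []      incr = []
  cycles-labels ρ w (v ∷ R) ((w<v ∷ w<R) ∷ v<R ∷ R<) =
    All.++⁺ (cycles-labels _ w R (w<R ∷ R<)) (All.++⁺ (cycles-labels _ v R (v<R ∷ R<))
      (All.++⁺ (All.map⁺ (All.map (∈-++⁺ʳ (map source (allFin n)) ∘ ∈-++⁺ˡ ∘ ∈-map⁺ cycle₁′ ∘ triple) v<R))
               (All.map⁺ (All.map (∈-++⁺ʳ (map source (allFin n)) ∘
                 ∈-++⁺ʳ (map cycle₁ (increasingTriples n)) ∘ ∈-map⁺ cycle₂′ ∘ triple) v<R))))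
    where
    cycle₁′ cycle₂′ : Triple → Label
    cycle₁′ t = cycle₁ t
    cycle₂′ t = cycle₂ t
    triple : ∀ {i} → v Fin.< i → (w , v , i) ∈ increasingTriples n
    triple v<i = increasingTriples-complete w<v v<i

  -- The recursion only orients free pairs, so outcomes already decided persist in every later term.
  -- This is what separates the two branches of a match.
  cycles-⊑ : ∀ (ρ : Partial) w R → Increasing (w ∷ R) → FreeOn ρ (w ∷ R) →
             All (λ e → ρ ⊑ proj₂ e) (cycles ρ w R)
  cycles-⊑ ρ w []      incr free = []
  cycles-⊑ ρ w (v ∷ R) incr free =
    All.++⁺ (All.map (λ ⊑e a b set → ⊑e a b (orient-⊑ ρ w v free-wv a b set)) (cycles-⊑ _ w R w-increasing w-free))
    (All.++⁺ (All.map (λ ⊑e a b set → ⊑e a b (orient-⊑ ρ v w free-vw a b set)) (cycles-⊑ _ v R v-increasing v-free))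
    (All.++⁺ (All.map⁺ (All.tabulate extend)) (All.map⁺ (All.tabulate extend))))
    where
    open Match {ρ = ρ} incr free
    extend : ∀ {i} → i ∈ R → ρ ⊑ orientAll i (others i R) ρ
    extend {i} i∈R = orientAll-⊑ ρ i (others-≢ i R) (others-unique i) (others-free {ρ = ρ} R-free i∈R)

  -- The middle of a cycle is the challenger of the match that produced it. The value at a source is
  -- empty, which also separates cycle terms from non-minimality terms.
  MiddleIn : List (Fin n) → Label → Set
  MiddleIn R (source _)           = ⊥
  MiddleIn R (cycle₁ (_ , j , _)) = j ∈ R
  MiddleIn R (cycle₂ (_ , j , _)) = j ∈ R

  cycles-middle : ∀ (ρ : Partial) w R → All (MiddleIn R ∘ proj₁) (cycles ρ w R)
  cycles-middle ρ w []      = []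
  cycles-middle ρ w (v ∷ R) =
    All.++⁺ (All.map (λ {e} → weaken (proj₁ e)) (cycles-middle _ w R))
    (All.++⁺ (All.map (λ {e} → weaken (proj₁ e)) (cycles-middle _ v R))
    (All.++⁺ (All.map⁺ (All.universal (λ _ → here refl) R)) (All.map⁺ (All.universal (λ _ → here refl) R))))
    where
    weaken : ∀ l → MiddleIn R l → MiddleIn (v ∷ R) l
    weaken (cycle₁ _) = there
    weaken (cycle₂ _) = there

  -- Terms from the two recursive branches disagree on the pair {w, v}, and
  -- the cycles of the current match are the only ones whose middle is v.
  cycles-unique : ∀ (ρ : Partial) w R → Increasing (w ∷ R) → FreeOn ρ (w ∷ R) → Unique (cycles ρ w R)
  cycles-unique ρ w []      incr free = []
  cycles-unique ρ w (v ∷ R) incr free =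
    Unique.++⁺ (cycles-unique _ w R w-increasing w-free)
      (Unique.++⁺ (cycles-unique _ v R v-increasing v-free)
        (Unique.++⁺ (Unique.map⁺ (λ { refl → refl }) R!) (Unique.map⁺ (λ { refl → refl }) R!) opposite)
        λ (p , q) → older (cycles-middle _ v R) p q)
      λ (p , q) → [ branches p , older (cycles-middle _ w R) p ] (∈-++⁻ (cycles (orient v w ρ) v R) q)
    where
    open Match {ρ = ρ} incr free
    R! : Unique R
    R! = increasing⇒unique R-increasing
    opposite : Disjoint (matchCycles₁ ρ w v R) (matchCycles₂ ρ w v R)
    opposite (p , q) with _ , _ , refl ← ∈-map⁻ _ p | _ , _ , () ← ∈-map⁻ _ q
    older : ∀ {e es} → All (MiddleIn R ∘ proj₁) es → e ∈ es → e ∈ matchCycles ρ w v R → ⊥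
    older middle p q with ∈-++⁻ (matchCycles₁ ρ w v R) q
    ... | inj₁ q′ with _ , _ , refl ← ∈-map⁻ _ q′ = All.lookup v∉R (All.lookup middle p) refl
    ... | inj₂ q′ with _ , _ , refl ← ∈-map⁻ _ q′ = All.lookup v∉R (All.lookup middle p) refl
    branches : ∀ {e} → e ∈ cycles (orient w v ρ) w R → e ∈ cycles (orient v w ρ) v R → ⊥
    branches p q with () ← trans
      (sym (All.lookup (cycles-⊑ _ w R w-increasing w-free) p _ _ (orient-< ρ w<v)))
      (All.lookup (cycles-⊑ _ v R v-increasing v-free) q _ _ (orient-> ρ w<v))

-- The polynomial identity

module TournamentPolynomials (n : ℕ) {c ℓ} (K : CommutativeRing c ℓ) where
  open Tournament n
  open CommutativeRing K renaming (refl to ≈-refl)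
  open import Relation.Binary.Reasoning.Setoid setoid
  open import Algebra.Solver.Ring.NaturalCoefficients.Default commutativeSemiring
  open ListFold *-commutativeMonoid using () renaming (fold to ∏)
  open ListFold +-commutativeMonoid renaming (fold to ∑; fold-++ to ∑-++; fold-cong to ∑-cong; fold-∙ to ∑-+)
  open RingIdentities K using (match-split; fold-*ˡ)

  -- The identity rests on two facts: opposite literals sum to 1, and orienting a free pair
  -- multiplies by its literal. `toMon` and `monValue` are kept apart because linear combinations
  -- list monomials while the identity concerns their values.
  module CycleExpansion
    (y : Fin n → Fin n → Carrier) (y-complement : ∀ i j → i ≢ j → y i j + y j i ≈ 1#)
    {Mon : Set} (toMon : Partial → Mon) (monValue : Mon → Carrier)
    (mono-orient : ∀ ρ i j → i ≢ j → Free ρ i j → monValue (toMon (orient i j ρ)) ≈ monValue (toMon ρ) * y i j)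
    where

    mono : Partial → Carrier
    mono ρ = monValue (toMon ρ)

    star : Fin n → List (Fin n) → Carrier
    star i L = ∏ (y i) (others i L)

    axiomValue : Label → Carrier
    axiomValue (source i)           = star i (allFin n)
    axiomValue (cycle₁ (i , j , k)) = y i j * y j k * y k i
    axiomValue (cycle₂ (i , j , k)) = y k j * y j i * y i k

    termValue : Label × Partial → Carrier
    termValue (l , ρ) = axiomValue l * mono ρ

    star-self : ∀ {w R} → All (w ≢_) R → star w (w ∷ R) ≈ ∏ (y w) R
    star-self {w} w∉R = reflexive (cong (∏ (y w)) (others-self w∉R))

    star-∷ : ∀ {i w R} → w ≢ i → star i (w ∷ R) ≈ y i w * star i R
    star-∷ {i} w≢i = reflexive (cong (∏ (y i)) (others-∷ w≢i))

    mono-orientAll : ∀ ρ i {js} → All (i ≢_) js → Unique js → All (Free ρ i) js →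
                     mono (orientAll i js ρ) ≈ mono ρ * ∏ (y i) js
    mono-orientAll ρ i []            []            []             = sym (*-identityʳ _)
    mono-orientAll ρ i {j ∷ js} (i≢j ∷ i∉js) (j∉js ∷ js!) (free ∷ frees) = begin
      mono (orient i j (orientAll i js ρ))    ≈⟨ mono-orient _ i j i≢j (orientAll-free ρ i i∉js j∉js free) ⟩
      mono (orientAll i js ρ) * y i j         ≈⟨ *-congʳ (mono-orientAll ρ i i∉js js! frees) ⟩
      mono ρ * ∏ (y i) js * y i j             ≈⟨ solve 3 (λ m p q → m :* p :* q := m :* (q :* p)) ≈-refl _ _ _ ⟩
      mono ρ * (y i j * ∏ (y i) js)           ∎

    -- Induction along the tournament. The winner's star in each branch lacks only the literal of
    -- the match just played, so it extends to all contestants at once. The stars of the elements of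
    -- `R` are paired across the branches.
    mono-expansion : ∀ ρ w R → Increasing (w ∷ R) → FreeOn ρ (w ∷ R) →
                     mono ρ ≈ ∑ (λ i → mono ρ * star i (w ∷ R)) (w ∷ R) + ∑ termValue (cycles ρ w R)
    mono-expansion ρ w []      incr free = begin
      mono ρ                                ≈⟨ *-identityʳ _ ⟨
      mono ρ * 1#                           ≈⟨ *-congˡ (star-self {w} []) ⟨
      mono ρ * star w (w ∷ [])              ≈⟨ +-identityʳ _ ⟨
      mono ρ * star w (w ∷ []) + 0#         ≈⟨ +-identityʳ _ ⟨
      mono ρ * star w (w ∷ []) + 0# + 0#    ∎
    mono-expansion ρ w (v ∷ R) incr free = begin
      m
        ≈⟨ *-identityʳ m ⟨
      m * 1#
        ≈⟨ *-congˡ (y-complement w v w≢v) ⟨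
      m * (y w v + y v w)
        ≈⟨ distribˡ m _ _ ⟩
      m * y w v + m * y v w
        ≈⟨ +-cong m₁≈ m₂≈ ⟨
      m₁ + m₂
        ≈⟨ +-cong (mono-expansion _ w R w-increasing w-free) (mono-expansion _ v R v-increasing v-free) ⟩
      -- Each sum over contestants is unfolded into the winner's term and the sum over `R`.
      (m₁ * star w (w ∷ R) + F₁ + C₁) + (m₂ * star v (v ∷ R) + F₂ + C₂)
        ≈⟨ solve 6 (λ a f₁ c₁ b f₂ c₂ → (a :+ f₁ :+ c₁) :+ (b :+ f₂ :+ c₂) := a :+ b :+ (c₁ :+ c₂) :+ (f₁ :+ f₂))
             ≈-refl _ _ _ _ _ _ ⟩
      m₁ * star w (w ∷ R) + m₂ * star v (v ∷ R) + (C₁ + C₂) + (F₁ + F₂)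
        ≈⟨ +-cong (+-congʳ (+-cong w-wins v-wins)) survivors ⟩
      m * star w L + m * star v L + (C₁ + C₂) + (G + (D₁ + D₂))
        ≈⟨ solve 7 (λ a b c₁ c₂ g d₁ d₂ → a :+ b :+ (c₁ :+ c₂) :+ (g :+ (d₁ :+ d₂)) :=
                      a :+ (b :+ g) :+ (c₁ :+ (c₂ :+ (d₁ :+ d₂))))
             ≈-refl _ _ _ _ _ _ _ ⟩
      m * star w L + (m * star v L + G) + (C₁ + (C₂ + (D₁ + D₂)))
        ≈⟨ +-congˡ (trans (∑-++ termValue (cycles _ w R) _) (+-congˡ
             (trans (∑-++ termValue (cycles _ v R) _) (+-congˡ
               (∑-++ termValue (matchCycles₁ ρ w v R) _))))) ⟨
      ∑ (λ i → m * star i L) L + ∑ termValue (cycles ρ w L′) ∎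
      where
      open Match {ρ = ρ} incr free
      L L′ : List (Fin n)
      L′ = v ∷ R
      L = w ∷ L′
      m m₁ m₂ F₁ F₂ C₁ C₂ G D₁ D₂ : Carrier
      m  = mono ρ
      m₁ = mono (orient w v ρ)
      m₂ = mono (orient v w ρ)
      F₁ = ∑ (λ i → m₁ * star i (w ∷ R)) R
      F₂ = ∑ (λ i → m₂ * star i (v ∷ R)) R
      C₁ = ∑ termValue (cycles (orient w v ρ) w R)
      C₂ = ∑ termValue (cycles (orient v w ρ) v R)
      G  = ∑ (λ i → m * star i L) R
      D₁ = ∑ termValue (matchCycles₁ ρ w v R)
      D₂ = ∑ termValue (matchCycles₂ ρ w v R)
      m₁≈ : m₁ ≈ m * y w v
      m₁≈ = mono-orient ρ w v w≢v free-wv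
      m₂≈ : m₂ ≈ m * y v w
      m₂≈ = mono-orient ρ v w (w≢v ∘ ≡.sym) free-vw

      w-wins : m₁ * star w (w ∷ R) ≈ m * star w L
      w-wins = begin
        m₁ * star w (w ∷ R)            ≈⟨ *-cong m₁≈ (star-self w∉R) ⟩
        m * y w v * ∏ (y w) R          ≈⟨ *-assoc _ _ _ ⟩
        m * (y w v * ∏ (y w) R)        ≈⟨ *-congˡ (star-self (w≢v ∷ w∉R)) ⟨
        m * star w L                   ∎

      v-wins : m₂ * star v (v ∷ R) ≈ m * star v L
      v-wins = begin
        m₂ * star v (v ∷ R)            ≈⟨ *-congʳ m₂≈ ⟩
        m * y v w * star v (v ∷ R)     ≈⟨ *-assoc _ _ _ ⟩
        m * (y v w * star v (v ∷ R))   ≈⟨ *-congˡ (star-∷ w≢v) ⟨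
        m * star v L                   ∎

      t₁ t₂ : Fin n → Label × Partial
      t₁ i = cycle₁ (w , v , i) , orientAll i (others i R) ρ
      t₂ i = cycle₂ (w , v , i) , orientAll i (others i R) ρ

      -- In one branch `i` beats `w`, in the other `v`; with `s` factored out, the sum is the left
      -- side of `match-split`.
      survivor : ∀ {i} → i ∈ R → m₁ * star i (w ∷ R) + m₂ * star i (v ∷ R) ≈
                                 m * star i L + (termValue (t₁ i) + termValue (t₂ i))
      survivor {i} i∈R = begin
        m₁ * star i (w ∷ R) + m₂ * star i (v ∷ R)
          ≈⟨ +-cong (*-cong m₁≈ (star-∷ w≢i)) (*-cong m₂≈ (star-∷ v≢i)) ⟩
        m * y w v * (y i w * star i R) + m * y v w * (y i v * star i R)
          ≈⟨ solve 6 (λ m c c′ a b s → m :* c :* (a :* s) :+ m :* c′ :* (b :* s) :=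
                        c :* (m :* s) :* a :+ c′ :* (m :* s) :* b)
               ≈-refl _ _ _ _ _ _ ⟩
        y w v * s * y i w + y v w * s * y i v
          ≈⟨ match-split (y i w) (y w i) (y i v) (y v i) (y w v) (y v w) s
               (y-complement i w (w≢i ∘ ≡.sym)) (y-complement i v (v≢i ∘ ≡.sym)) (y-complement w v w≢v) ⟩
        s * (y i w * y i v) + (y w v * y v i * y i w * s + y i v * y v w * y w i * s)
          ≈⟨ +-cong (solve 4 (λ m s a b → m :* s :* (a :* b) := m :* (a :* (b :* s)))
                       ≈-refl _ _ _ _)
                    (+-cong (*-congˡ (sym dominated)) (*-congˡ (sym dominated))) ⟩
        m * (y i w * (y i v * star i R)) + (termValue (t₁ i) + termValue (t₂ i))
          ≈⟨ +-congʳ (*-congˡ (trans (star-∷ w≢i) (*-congˡ (star-∷ v≢i)))) ⟨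
        m * star i L + (termValue (t₁ i) + termValue (t₂ i)) ∎
        where
        s : Carrier
        s = m * star i R
        w≢i : w ≢ i
        w≢i = All.lookup w∉R i∈R
        v≢i : v ≢ i
        v≢i = All.lookup v∉R i∈R
        dominated : mono (orientAll i (others i R) ρ) ≈ s
        dominated = mono-orientAll ρ i (others-≢ i R) (others-unique i) (others-free {ρ = ρ} R-free i∈R)

      survivors : F₁ + F₂ ≈ G + (D₁ + D₂)
      survivors = begin
        F₁ + F₂
          ≈⟨ ∑-+ _ _ R ⟨
        ∑ (λ i → m₁ * star i (w ∷ R) + m₂ * star i (v ∷ R)) R
          ≈⟨ ∑-cong (All.tabulate survivor) ⟩
        ∑ (λ i → m * star i L + (termValue (t₁ i) + termValue (t₂ i))) R
          ≈⟨ ∑-+ _ _ R ⟩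
        G + ∑ (λ i → termValue (t₁ i) + termValue (t₂ i)) R
          ≈⟨ +-congˡ (∑-+ _ _ R) ⟩
        G + (∑ (termValue ∘ t₁) R + ∑ (termValue ∘ t₂) R)
          ≈⟨ +-congˡ (+-cong (fold-map termValue t₁ R) (fold-map termValue t₂ R)) ⟨
        G + (D₁ + D₂) ∎

    monomialsAt : List (Label × Partial) → Label → List Mon
    monomialsAt es l = map (λ e → toMon (proj₂ e)) (filter (λ e → proj₁ e ≟ₗ l) es)

    -- Here `t` stands for a monomial with its explicit coefficient 1, as `combinationPoly` writes
    -- it. The terms are regrouped by `fold-fibres`, one fibre per axiom.
    ∑-by-axiom : (t : Mon → Carrier) → (∀ r → t r ≈ monValue r) → ∀ {es} → All (λ e → proj₁ e ∈ labels) es →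
                 ∑ (λ l → axiomValue l * ∑ t (monomialsAt es l)) labels ≈ ∑ termValue es
    ∑-by-axiom t t≈ {es} es∈ = trans (∑-cong (All.universal group labels))
                                     (fold-fibres _≟ₗ_ proj₁ termValue labels-unique es∈)
      where
      group : ∀ l → axiomValue l * ∑ t (monomialsAt es l) ≈ ∑ termValue (filter (λ e → proj₁ e ≟ₗ l) es)
      group l = begin
        axiomValue l * ∑ t (monomialsAt es l)
          ≈⟨ *-congˡ (fold-map t (λ e → toMon (proj₂ e)) at-l) ⟩
        axiomValue l * ∑ (λ e → t (toMon (proj₂ e))) at-l
          ≈⟨ fold-*ˡ (axiomValue l) _ at-l ⟨
        ∑ (λ e → axiomValue l * t (toMon (proj₂ e))) at-l
          ≈⟨ ∑-cong (All.map (λ { refl → *-congˡ (t≈ _) }) (All.all-filter (λ e → proj₁ e ≟ₗ l) es)) ⟩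
        ∑ termValue at-l ∎
        where
        at-l : List (Label × Partial)
        at-l = filter (λ e → proj₁ e ≟ₗ l) es

    -- The root of the recursion: nothing is decided, the monomial is 1, and the stars over all
    -- elements are the non-minimality axioms themselves.
    ∑-sources : monValue (toMon undecided) ≈ 1# → ∀ w R → w ∷ R ≡ allFin n →
                ∑ termValue (map (λ i → source i , undecided) (allFin n) ++ cycles undecided w R) ≈ 1#
    ∑-sources mono≈1 w R L≡ = begin
      ∑ termValue (map (λ i → source i , undecided) (allFin n) ++ cycles undecided w R)
        ≈⟨ ∑-++ termValue (map (λ i → source i , undecided) (allFin n)) _ ⟩
      ∑ termValue (map (λ i → source i , undecided) (allFin n)) + D
        ≈⟨ +-congʳ (fold-map termValue (λ i → source i , undecided) (allFin n)) ⟩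
      ∑ (λ i → star i (allFin n) * mono undecided) (allFin n) + D
        ≈⟨ +-congʳ (∑-cong (All.universal (λ i → *-comm _ _) (allFin n))) ⟩
      ∑ (λ i → mono undecided * star i (allFin n)) (allFin n) + D
        ≡⟨ cong (λ L → ∑ (λ i → mono undecided * star i L) L + D) L≡ ⟨
      ∑ (λ i → mono undecided * star i (w ∷ R)) (w ∷ R) + D
        ≈⟨ mono-expansion undecided w R
             (≡.subst Increasing (≡.sym L≡) (AllPairs.tabulate⁺-< (λ i<j → i<j)))
             (λ {k} {l} _ _ → undecided-free k l) ⟨
      mono undecided
        ≈⟨ mono≈1 ⟩
      1# ∎
      where
      D : Carrier
      D = ∑ termValue (cycles undecided w R)

-- Monomials

-- Treats both halves of `monomialPoly` at once: `isTrue` with variables gives the factor over `S`,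
-- `isFalse` with complements the factor over `T`.
module Mask {c ℓ} (M : CommutativeMonoid c ℓ) {N : ℕ} (h : Maybe Bool → Bool) (h-nothing : h nothing ≡ false)
  (f : Fin N → CommutativeMonoid.Carrier M) where
  open CommutativeMonoid M hiding (refl)
  open ListFold M

  masked : Vec (Maybe Bool) N → Carrier
  masked ρ = fold f (filter (_∈? Vec.map h ρ) (allFin N))

  choice : Maybe Bool → Fin N → Carrier
  choice s i = if h s then f i else ε

  does-∈? : ∀ {N} (i : Fin N) (S : Subset N) → does (i ∈? S) ≡ lookup S i
  does-∈? zero    (true  Vec.∷ S) = refl
  does-∈? zero    (false Vec.∷ S) = refl
  does-∈? (suc i) (_     Vec.∷ S) = does-∈? i S

  -- As a product over all indices with neutral factors, a change of one entry is a change of one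
  -- factor, and `fold-update` applies.
  masked≈fold : ∀ ρ → masked ρ ≈ fold (λ i → choice (lookup ρ i) i) (allFin N)
  masked≈fold ρ = trans (fold-filter (_∈? Vec.map h ρ) f (allFin N))
    (fold-cong (All.universal (λ i → reflexive (cong (if_then f i else ε)
      (≡.trans (does-∈? i (Vec.map h ρ)) (Vec.lookup-map i h ρ)))) (allFin N)))

  choice-nothing : ∀ i → choice nothing i ≈ ε
  choice-nothing i = reflexive (cong (if_then f i else ε) h-nothing)

  masked-replicate : masked (Vec.replicate N nothing) ≈ ε
  masked-replicate = trans (masked≈fold _) (trans
    (fold-cong (All.universal (λ i → trans (reflexive (cong (λ s → choice s i) (Vec.lookup-replicate i nothing)))
                                           (choice-nothing i)) (allFin N)))
    (fold-ε (allFin N)))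

  masked-update : ∀ ρ a s → lookup ρ a ≡ nothing → masked (ρ [ a ]≔ s) ≈ choice s a ∙ masked ρ
  masked-update ρ a s unset = trans (masked≈fold _) (trans
    (fold-update (Unique.allFin⁺ N) (∈-allFin a)
      (λ i i≢a → reflexive (cong (λ t → choice t i) (Vec.lookup∘update′ i≢a ρ s)))
      (trans (reflexive (cong (λ t → choice t a) (Vec.lookup∘update a ρ s)))
        -- The entry was unset before, so its old factor is neutral.
        (sym (trans (∙-congˡ (trans (reflexive (cong (λ t → choice t a) unset)) (choice-nothing a)))
                    (identityʳ _)))))
    (∙-congˡ (sym (masked≈fold ρ))))

isTrue isFalse : Maybe Bool → Bool
isTrue  (just true)  = true
isTrue  _            = false
isFalse (just false) = true
isFalse _            = false

toMonomial : ∀ {N} → Vec (Maybe Bool) N → Monomial N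
toMonomial ρ = monomial (Vec.map isTrue ρ) (Vec.map isFalse ρ) λ (a , a∈) →
  let (a∈S , a∈T) = x∈p∩q⁻ (Vec.map isTrue ρ) (Vec.map isFalse ρ) a∈ in
  exclusive (lookup ρ a) (≡.trans (≡.sym (Vec.lookup-map a isTrue ρ)) (Vec.[]=⇒lookup a∈S))
                         (≡.trans (≡.sym (Vec.lookup-map a isFalse ρ)) (Vec.[]=⇒lookup a∈T))
  where
  exclusive : ∀ s → isTrue s ≡ true → isFalse s ≡ true → ⊥
  exclusive (just true) _ ()

-- An entry is determined by its values under `isTrue` and `isFalse`, which `S` and `T` record.
toMonomial-injective : ∀ {N} (ρ σ : Vec (Maybe Bool) N) → toMonomial ρ ≡ toMonomial σ → ρ ≡ σ
toMonomial-injective ρ σ eq = entries ρ σ (cong Monomial.S eq) (cong Monomial.T eq)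
  where
  entry : ∀ s t → isTrue s ≡ isTrue t → isFalse s ≡ isFalse t → s ≡ t
  entry (just true)  (just true)  _ _ = refl
  entry (just false) (just false) _ _ = refl
  entry nothing      nothing      _ _ = refl
  entry (just true)  (just false) () _
  entry (just true)  nothing      () _
  entry (just false) (just true)  () _
  entry (just false) nothing      _ ()
  entry nothing      (just true)  () _
  entry nothing      (just false) _ ()
  entries : ∀ {N} (ρ σ : Vec (Maybe Bool) N) → Vec.map isTrue ρ ≡ Vec.map isTrue σ →
            Vec.map isFalse ρ ≡ Vec.map isFalse σ → ρ ≡ σ
  entries Vec.[]      Vec.[]      _  _  = refl
  entries (s Vec.∷ ρ) (t Vec.∷ σ) eqS eqT = cong₂ Vec._∷_
    (entry s t (Vec.∷-injectiveˡ eqS) (Vec.∷-injectiveˡ eqT))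
    (entries ρ σ (Vec.∷-injectiveʳ eqS) (Vec.∷-injectiveʳ eqT))

open PolynomialRing ℝ-commutativeRing using (polynomialRing)

module MonomialPoly (N : ℕ) where
  open CommutativeRing (polynomialRing N) renaming (refl to ≈-refl)
  open import Relation.Binary.Reasoning.Setoid setoid
  open import Algebra.Properties.CommutativeSemigroup
    (CommutativeMonoid.commutativeSemigroup *-commutativeMonoid) using (x∙yz≈xz∙y)
  module S = Mask *-commutativeMonoid isTrue refl (var {N})
  module T = Mask *-commutativeMonoid isFalse refl (λ b → 1ₚ -ₚ var {N} b)

  mono-undecided : monomialPoly (toMonomial (Vec.replicate N nothing)) ≈ 1ₚ
  mono-undecided = trans {monomialPoly (toMonomial (Vec.replicate N nothing))} {1ₚ *ₚ 1ₚ} {1ₚ}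
    (*-cong {S.masked (Vec.replicate N nothing)} {1ₚ} {T.masked (Vec.replicate N nothing)} {1ₚ}
      S.masked-replicate T.masked-replicate)
    (*-identityˡ 1ₚ)

  mono-update : ∀ ρ a s → lookup ρ a ≡ nothing →
                monomialPoly (toMonomial (ρ [ a ]≔ s)) ≈ (S.choice s a *ₚ S.masked ρ) *ₚ (T.choice s a *ₚ T.masked ρ)
  mono-update ρ a s unset =
    *-cong {S.masked (ρ [ a ]≔ s)} {S.choice s a *ₚ S.masked ρ} {T.masked (ρ [ a ]≔ s)} {T.choice s a *ₚ T.masked ρ}
      (S.masked-update ρ a s unset) (T.masked-update ρ a s unset)

  mono-update-true : ∀ ρ a → lookup ρ a ≡ nothing →
                     monomialPoly (toMonomial (ρ [ a ]≔ just true)) ≈ monomialPoly (toMonomial ρ) *ₚ var a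
  mono-update-true ρ a unset = begin
    monomialPoly (toMonomial (ρ [ a ]≔ just true))
      ≈⟨ mono-update ρ a (just true) unset ⟩
    (var a *ₚ S.masked ρ) *ₚ (1ₚ *ₚ T.masked ρ)
      ≈⟨ *-congˡ {var a *ₚ S.masked ρ} {1ₚ *ₚ T.masked ρ} {T.masked ρ} (*-identityˡ (T.masked ρ)) ⟩
    (var a *ₚ S.masked ρ) *ₚ T.masked ρ
      ≈⟨ *-assoc (var a) (S.masked ρ) (T.masked ρ) ⟩
    var a *ₚ (S.masked ρ *ₚ T.masked ρ)
      ≈⟨ *-comm (var a) (monomialPoly (toMonomial ρ)) ⟩
    monomialPoly (toMonomial ρ) *ₚ var a ∎

  mono-update-false : ∀ ρ a → lookup ρ a ≡ nothing →
                      monomialPoly (toMonomial (ρ [ a ]≔ just false)) ≈ monomialPoly (toMonomial ρ) *ₚ (1ₚ -ₚ var a)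
  mono-update-false ρ a unset = begin
    monomialPoly (toMonomial (ρ [ a ]≔ just false))
      ≈⟨ mono-update ρ a (just false) unset ⟩
    (1ₚ *ₚ S.masked ρ) *ₚ (ȳ *ₚ T.masked ρ)
      ≈⟨ *-congʳ {ȳ *ₚ T.masked ρ} {1ₚ *ₚ S.masked ρ} {S.masked ρ} (*-identityˡ (S.masked ρ)) ⟩
    S.masked ρ *ₚ (ȳ *ₚ T.masked ρ)
      ≈⟨ x∙yz≈xz∙y (S.masked ρ) ȳ (T.masked ρ) ⟩
    monomialPoly (toMonomial ρ) *ₚ ȳ ∎
    where
    ȳ : Poly N
    ȳ = 1ₚ -ₚ var a

-- The comparison is an argument because `with` would normalise goals that
-- mention polynomials, and with them the real coefficients.
literal : ∀ {n} (i j : Fin n) → Comparison i j → Poly (numPairs n)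
literal i j (tri< i<j _ _) = var (pairIndex i j i<j)
literal i j (tri≈ _ _ _)   = 0ₚ
literal i j (tri> _ _ j<i) = 1ₚ -ₚ var (pairIndex j i j<i)

x≡literal : ∀ {n} (i j : Fin n) → x i j ≡ literal i j (Fin.<-cmp i j)
x≡literal i j with Fin.<-cmp i j
... | tri< _ _ _ = refl
... | tri≈ _ _ _ = refl
... | tri> _ _ _ = refl

complement : ∀ {N} (p q y : Poly N) → p ≡ y × q ≡ 1ₚ -ₚ y ⊎ q ≡ y × p ≡ 1ₚ -ₚ y → p +ₚ q ≈ₚ 1ₚ
complement {N} p q y (inj₁ (refl , refl)) = RingIdentities.x+[1-x]≈1 (polynomialRing N) y
complement {N} p q y (inj₂ (refl , refl)) =
  P.trans {p +ₚ q} {q +ₚ p} {1ₚ} (P.+-comm p q) (RingIdentities.x+[1-x]≈1 (polynomialRing N) q)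
  where module P = CommutativeRing (polynomialRing N)

literal-complement : ∀ {n} {i j : Fin n} → i ≢ j → ∀ s t → literal i j s +ₚ literal j i t ≈ₚ 1ₚ
literal-complement i≢j (tri≈ _ i≡j _) _              = ⊥-elim (i≢j i≡j)
literal-complement i≢j (tri< i<j _ _) (tri< _ _ i≮j) = ⊥-elim (i≮j i<j)
literal-complement i≢j (tri< i<j _ _) (tri≈ _ _ i≮j) = ⊥-elim (i≮j i<j)
literal-complement {i = i} {j} i≢j s@(tri< i<j _ _) t@(tri> _ _ i<j′) =
  complement (literal i j s) (literal j i t) (var (pairIndex i j i<j))
    -- The two comparisons carry separate proofs of `i < j`, which irrelevance identifies.
    (inj₁ (refl , cong (λ p → 1ₚ -ₚ var (pairIndex i j p)) (ℕ.<-irrelevant i<j′ i<j)))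
literal-complement {i = i} {j} i≢j s@(tri> _ _ j<i) t@(tri< j<i′ _ _) =
  complement (literal i j s) (literal j i t) (var (pairIndex j i j<i′))
    (inj₂ (refl , cong (λ p → 1ₚ -ₚ var (pairIndex j i p)) (ℕ.<-irrelevant j<i j<i′)))
literal-complement i≢j (tri> _ _ j<i) (tri≈ j≮i _ _) = ⊥-elim (j≮i j<i)
literal-complement i≢j (tri> _ _ j<i) (tri> j≮i _ _) = ⊥-elim (j≮i j<i)

x-complement : ∀ {n} (i j : Fin n) → i ≢ j → x i j +ₚ x j i ≈ₚ 1ₚ
x-complement i j i≢j = ≡.subst₂ (λ p q → p +ₚ q ≈ₚ 1ₚ) (≡.sym (x≡literal i j)) (≡.sym (x≡literal j i))
  (literal-complement i≢j (Fin.<-cmp i j) (Fin.<-cmp j i))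

-- Nullstellensatz proofs

assign : (f : A → B) (Q : A → C) (ls : List A) → Fin (length (map f ls)) → C
assign f Q (l ∷ ls) zero    = Q l
assign f Q (l ∷ ls) (suc i) = assign f Q ls i

-- Generic in `G` because the identity, the size and the total coefficient size all have to pass
-- from positions to labels.
map-assign : ∀ {d} {D : Set d} (f : A → B) (Q : A → C) (G : B → C → D) ls →
             map (λ i → G (List.lookup (map f ls) i) (assign f Q ls i)) (allFin _) ≡ map (λ l → G (f l) (Q l)) ls
map-assign f Q G ls = ≡.trans (List.map-tabulate (λ i → i) _) (go ls)
  where
  go : ∀ ls → tabulate (λ i → G (List.lookup (map f ls) i) (assign f Q ls i)) ≡ map (λ l → G (f l) (Q l)) ls
  go []       = refl
  go (l ∷ ls) = cong (G (f l) (Q l) ∷_) (go ls)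

∑ₚ-zero : ∀ {N} (ks : List A) → ∑ₚ (map (λ _ → 0ₚ {N}) ks) ≡ 0ₚ
∑ₚ-zero []       = refl
∑ₚ-zero (_ ∷ ks) = ∑ₚ-zero ks

proofFromLabels : ∀ {N} (f : A → Poly N) (Q : A → LinearCombination N) ls →
                  ∑ₚ (map (λ l → f l *ₚ combinationPoly (Q l)) ls) ≈ₚ 1ₚ →
                  NullstellensatzProof (List.lookup (map f ls))
proofFromLabels {N = N} f Q ls ∑≈1 = record
  { q        = assign f Q ls
  ; g        = λ _ → 0ₚ
  ; identity = λ e → ≈ℝ-sym {coeff rhs e} {coeff (1ₚ {N}) e}
                       (≡.subst (λ p → p ≈ₚ 1ₚ) (≡.sym rhs≡) ∑≈1 e)
  }
  where
  weakenings rhs : Poly N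
  weakenings = ∑ₚ (map (λ i → List.lookup (map f ls) i *ₚ combinationPoly (assign f Q ls i)) (allFin _))
  rhs = weakenings +ₚ ∑ₚ (map (λ a → 0ₚ *ₚ (var a *ₚ var a -ₚ var a)) (allFin N))
  rhs≡ : rhs ≡ ∑ₚ (map (λ l → f l *ₚ combinationPoly (Q l)) ls)
  -- A product with `0ₚ` on the left computes to the empty list, so the Boolean part is a sum of
  -- zeros.
  rhs≡ = ≡.trans (cong (weakenings +ₚ_) (∑ₚ-zero (allFin N)))
           (≡.trans (List.++-identityʳ weakenings)
             (cong ∑ₚ (map-assign f Q (λ p q → p *ₚ combinationPoly q) ls)))

-- Converting 1ₚ to const 1ℝ inside a product would unfold real arithmetic.
const-1 : ∀ {N} (p : Poly N) → const 1ℝ *ₚ p ≈ₚ p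
const-1 {N} p = ≡.subst (λ k → k *ₚ p ≈ₚ p) 1ₚ≡const-1 (CommutativeRing.*-identityˡ (polynomialRing N) p)
  where
  1ₚ≡const-1 : 1ₚ {N} ≡ const 1ℝ
  1ₚ≡const-1 = refl

-- Real arithmetic for coefficients equal to 1

1ℝ≉0ℝ : ¬ 1ℝ ≈ℝ 0ℝ
-- At ε = 1 closeness would mean 1 < 1.
1ℝ≉0ℝ 1≈0 = let (N , h) = 1≈0 1ℚ (ℚ.positive⁻¹ 1ℚ) in ℚ.<-irrefl refl (h N ℕ.≤-refl)

-- The fraction `k / 1` is normalised by a gcd and does not compute for variable `k`; unnormalised
-- rationals avoid this.
fromℕ-suc : ∀ k → 1ℝ +ℝ fromℕ k ≈ℝ fromℕ (suc k)
fromℕ-suc k = pointwise⇒≈ℝ (1ℝ +ℝ fromℕ k) (fromℕ (suc k)) λ _ → ℚ.toℚᵘ-injective (begin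
  ℚ.toℚᵘ (1ℚ ℚ.+ ℤ.+ k ℚ./ 1)               ≈⟨ ℚ.toℚᵘ-homo-+ 1ℚ (ℤ.+ k ℚ./ 1) ⟩
  ℚᵘ.1ℚᵘ ℚᵘ.+ ℚ.toℚᵘ (ℤ.+ k ℚ./ 1)          ≈⟨ ℚᵘ.+-congʳ ℚᵘ.1ℚᵘ (ℚ.toℚᵘ-fromℚᵘ (ℚᵘ.mkℚᵘ (ℤ.+ k) 0)) ⟩
  ℚᵘ.1ℚᵘ ℚᵘ.+ ℚᵘ.mkℚᵘ (ℤ.+ k) 0             ≈⟨ ℚᵘ.*≡* (cong (λ z → (ℤ.1ℤ ℤ.+ z) ℤ.* ℤ.1ℤ) (ℤ.*-identityʳ (ℤ.+ k))) ⟩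
  ℚᵘ.mkℚᵘ (ℤ.+ suc k) 0                     ≈⟨ ℚ.toℚᵘ-fromℚᵘ (ℚᵘ.mkℚᵘ (ℤ.+ suc k) 0) ⟨
  ℚ.toℚᵘ (ℤ.+ suc k ℚ./ 1)                  ∎)
  where open import Relation.Binary.Reasoning.Setoid ℚᵘ.≃-setoid

module ℝ+ where
  open CommutativeRing ℝ-commutativeRing public
  open ListFold +-commutativeMonoid public

∑ℝ-ones : ∀ (ks : List A) → ∑ℝ (map (λ _ → ∣ 1ℝ ∣ℝ) ks) ≈ℝ fromℕ (length ks)
∑ℝ-ones []       = pointwise⇒≈ℝ 0ℝ (fromℕ 0) λ _ → refl
∑ℝ-ones (_ ∷ ks) = ℝ+.trans {∣ 1ℝ ∣ℝ +ℝ ∑} {1ℝ +ℝ fromℕ (length ks)} {fromℕ (suc (length ks))}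
  (ℝ+.+-cong {∣ 1ℝ ∣ℝ} {1ℝ} {∑} {fromℕ (length ks)} (pointwise⇒≈ℝ ∣ 1ℝ ∣ℝ 1ℝ λ _ → refl) (∑ℝ-ones ks))
  (fromℕ-suc (length ks))
  where
  ∑ : _
  ∑ = ∑ℝ (map (λ _ → ∣ 1ℝ ∣ℝ) ks)

sum-ones : ∀ (ks : List A) → sum (map (λ _ → 1) ks) ≡ length ks
sum-ones []       = refl
sum-ones (_ ∷ ks) = cong suc (sum-ones ks)

map-constant : ∀ {d} {D : Set d} (g : C → D) (c : C) (h : A → B) ks →
               map (λ (c , _) → g c) (map (c ,_) (map h ks)) ≡ map (λ _ → g c) ks
map-constant g c h []       = refl
map-constant g c h (k ∷ ks) = cong (g c ∷_) (map-constant g c h ks)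

map-uncurry : ∀ (g : C → A → B) (c : C) ks → map (g c) ks ≡ map (λ (c , k) → g c k) (map (c ,_) ks)
map-uncurry g c []       = refl
map-uncurry g c (k ∷ ks) = cong (g c k ∷_) (map-uncurry g c ks)

-- From a list of terms to a proof for the ordering principle

module OrderingPrinciple (n : ℕ) where
  open Tournament n
  open MonomialPoly (numPairs n)
  open TournamentPolynomials n (polynomialRing (numPairs n)) using (module CycleExpansion)
  module ℕ+ = ListFold ℕ.+-0-commutativeMonoid

  mono-orient : ∀ ρ i j → i ≢ j → Free ρ i j →
                monomialPoly (toMonomial (orient i j ρ)) ≈ₚ monomialPoly (toMonomial ρ) *ₚ x i j
  mono-orient ρ i j i≢j free =
    ≡.subst (λ p → monomialPoly (toMonomial (orient i j ρ)) ≈ₚ monomialPoly (toMonomial ρ) *ₚ p)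
      (≡.sym (x≡literal i j)) (by (Fin.<-cmp i j) free)
    where
    by : ∀ t → FreeAt ρ i j t →
         monomialPoly (toMonomial (orientAt i j t ρ)) ≈ₚ monomialPoly (toMonomial ρ) *ₚ literal i j t
    by (tri< i<j _ _) = mono-update-true ρ (pairIndex i j i<j)
    by (tri≈ _ i≡j _) = ⊥-elim (i≢j i≡j)
    by (tri> _ _ j<i) = mono-update-false ρ (pairIndex j i j<i)

  open CycleExpansion x x-complement toMonomial monomialPoly mono-orient public

  combinationAt : ∀ es → Unique es → Label → LinearCombination (numPairs n)
  combinationAt es es! l = record
    { terms    = map (1ℝ ,_) (monomialsAt es l)
    ; distinct = AllPairs.map⁺ (AllPairs.map⁺ (AllPairs.map⁺ (distinct-monomials
                   (All.all-filter (λ e → proj₁ e ≟ₗ l) es) (Unique.filter⁺ _ es!))))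
    ; nonzero  = All.map⁺ (All.universal (λ _ → 1ℝ≉0ℝ) (monomialsAt es l))
    }
    where
    -- Within one fibre the label is fixed, so distinct terms differ in their partial tournament and
    -- hence in their monomial.
    distinct-monomials : ∀ {fs} → All (λ e → proj₁ e ≡ l) fs → Unique fs →
                         AllPairs (λ e f → toMonomial (proj₂ e) ≢ toMonomial (proj₂ f)) fs
    distinct-monomials []           []           = []
    distinct-monomials (refl ∷ ls) (e∉fs ∷ fs!) =
      All.zipWith (λ { (refl , e≢f) eq → e≢f (cong (l ,_) (toMonomial-injective _ _ eq)) }) (ls , e∉fs)
      ∷ distinct-monomials ls fs!

  ordAxioms≡ : ordAxioms n ≡ map axiomValue labels
  ordAxioms≡ = ≡.sym (≡.trans (List.map-++ axiomValue (map source (allFin n)) _) (cong₂ _++_ (≡.sym (List.map-∘ (allFin n)))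
    (≡.trans (List.map-++ axiomValue (map cycle₁ (increasingTriples n)) _)
             (cong₂ _++_ (≡.sym (List.map-∘ (increasingTriples n))) (≡.sym (List.map-∘ (increasingTriples n)))))))

  ∑-combinations : ∀ es es! → All (λ e → proj₁ e ∈ labels) es → ∑ₚ (map termValue es) ≈ₚ 1ₚ →
                   ∑ₚ (map (λ l → axiomValue l *ₚ combinationPoly (combinationAt es es! l)) labels) ≈ₚ 1ₚ
  ∑-combinations es es! es∈ ∑≈1 = ≡.subst (_≈ₚ 1ₚ)
    (cong ∑ₚ (List.map-cong (λ l → cong (λ ps → axiomValue l *ₚ ∑ₚ ps)
        (map-uncurry (λ c r → const c *ₚ monomialPoly r) 1ℝ (monomialsAt es l))) labels))
    (P.trans {∑ₚ (map (λ l → axiomValue l *ₚ ∑ₚ (map (λ r → const 1ℝ *ₚ monomialPoly r) (monomialsAt es l))) labels)}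
             {∑ₚ (map termValue es)} {1ₚ}
      (∑-by-axiom (λ r → const 1ℝ *ₚ monomialPoly r) (λ r → const-1 (monomialPoly r)) es∈) ∑≈1)
    where module P = CommutativeRing (polynomialRing (numPairs n))

  -- The fibres over `labels` partition `es`, so counting axiom by axiom counts each term once.
  ∑-lengths : ∀ es es! → All (λ e → proj₁ e ∈ labels) es →
              sum (map (λ l → length (terms (combinationAt es es! l))) labels) ≡ length es
  ∑-lengths es es! es∈ = begin
    sum (map (λ l → length (terms (combinationAt es es! l))) labels)
      ≡⟨ cong sum (List.map-cong lengthAt labels) ⟩
    sum (map (λ l → sum (map (λ _ → 1) (filter (λ e → proj₁ e ≟ₗ l) es))) labels)
      ≡⟨ ℕ+.fold-fibres _≟ₗ_ proj₁ (λ _ → 1) labels-unique es∈ ⟩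
    sum (map (λ _ → 1) es)
      ≡⟨ sum-ones es ⟩
    length es ∎
    where
    open ≡.≡-Reasoning
    lengthAt : ∀ l → length (terms (combinationAt es es! l)) ≡ sum (map (λ _ → 1) (filter (λ e → proj₁ e ≟ₗ l) es))
    lengthAt l = begin
      length (terms (combinationAt es es! l))
        ≡⟨ List.length-map {B = ℝ × Monomial (numPairs n)} (1ℝ ,_) (monomialsAt es l) ⟩
      length (monomialsAt es l)
        ≡⟨ List.length-map (λ e → toMonomial (proj₂ e)) (filter (λ e → proj₁ e ≟ₗ l) es) ⟩
      length (filter (λ e → proj₁ e ≟ₗ l) es)
        ≡⟨ sum-ones (filter (λ e → proj₁ e ≟ₗ l) es) ⟨
      sum (map (λ _ → 1) (filter (λ e → proj₁ e ≟ₗ l) es)) ∎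

  ∑-coefficients : ∀ es es! → All (λ e → proj₁ e ∈ labels) es →
                   ∑ℝ (map (λ l → ∑ℝ (map (λ (c , _) → ∣ c ∣ℝ) (terms (combinationAt es es! l)))) labels) ≈ℝ
                   fromℕ (length es)
  ∑-coefficients es es! es∈ = begin
    ∑ℝ (map (λ l → ∑ℝ (map (λ (c , _) → ∣ c ∣ℝ) (terms (combinationAt es es! l)))) labels)
      ≡⟨ cong ∑ℝ (List.map-cong (λ l → cong ∑ℝ (map-constant ∣_∣ℝ 1ℝ (λ e → toMonomial (proj₂ e))
           (filter (λ e → proj₁ e ≟ₗ l) es))) labels) ⟩
    ∑ℝ (map (λ l → ∑ℝ (map (λ _ → ∣ 1ℝ ∣ℝ) (filter (λ e → proj₁ e ≟ₗ l) es))) labels)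
      ≈⟨ ℝ+.fold-fibres _≟ₗ_ proj₁ (λ _ → ∣ 1ℝ ∣ℝ) labels-unique es∈ ⟩
    ∑ℝ (map (λ _ → ∣ 1ℝ ∣ℝ) es)
      ≈⟨ ∑ℝ-ones es ⟩
    fromℕ (length es) ∎
    where open import Relation.Binary.Reasoning.Setoid ℝ+.setoid

  proofFromTerms : ∀ es → Unique es → All (λ e → proj₁ e ∈ labels) es →
                   ∑ₚ (map termValue es) ≈ₚ 1ₚ →
                   Σ (NullstellensatzProof (ORD n)) λ π →
                     size π ≡ length es × totalCoefficientSize π ≈ℝ fromℕ (length es)
  proofFromTerms es es! es∈ ∑≈1 = go (ordAxioms n) ordAxioms≡
    where
    Q : Label → LinearCombination (numPairs n)
    Q = combinationAt es es!

    -- With the axiom list generalised to `ps`, matching on the equation replaces it in the proof,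
    -- its size and its coefficients together.
    go : ∀ ps → ps ≡ map axiomValue labels →
         Σ (NullstellensatzProof (List.lookup ps)) λ π →
           size π ≡ length es × totalCoefficientSize π ≈ℝ fromℕ (length es)
    go _ refl = proofFromLabels axiomValue Q labels (∑-combinations es es! es∈ ∑≈1)
      , ≡.trans (cong sum (map-assign axiomValue Q (λ _ q → length (terms q)) labels)) (∑-lengths es es! es∈)
      , ≡.subst (λ cs → ∑ℝ cs ≈ℝ fromℕ (length es))
          (≡.sym (map-assign axiomValue Q (λ _ q → ∑ℝ (map (λ (c , _) → ∣ c ∣ℝ) (terms q))) labels))
          (∑-coefficients es es! es∈)

-- Assembly and the final count

theorem2 : (n : ℕ) → 3 ≤ n →
    Σ (NullstellensatzProof (ORD n)) λ π →
    (size π ≡ 2 ^ n ∸ n) × (totalCoefficientSize π ≈ℝ fromℕ (2 ^ n ∸ n))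
theorem2 n@(suc m) _ =
  ≡.subst (λ k → Σ (NullstellensatzProof (ORD n)) λ π → (size π ≡ k) × (totalCoefficientSize π ≈ℝ fromℕ k)) count
    (proofFromTerms es es! es∈ (∑-sources mono-undecided zero R refl))
  where
  open Tournament n
  open MonomialPoly (numPairs n) using (mono-undecided)
  open OrderingPrinciple n using (∑-sources; proofFromTerms)
  R : List (Fin n)
  -- The first champion is `zero`; `zero ∷ R` is `allFin n` by computation.
  R = tabulate suc
  sources Cs es : List (Label × Partial)
  sources = map (λ i → source i , undecided) (allFin n)
  Cs = cycles undecided zero R
  es = sources ++ Cs
  increasing : Increasing (zero ∷ R)
  increasing = AllPairs.tabulate⁺-< (λ i<j → i<j)
  es! : Unique es
  es! = Unique.++⁺ (Unique.map⁺ (λ { refl → refl }) (Unique.allFin⁺ n))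
    (cycles-unique undecided zero R increasing (λ {k} {l} _ _ → undecided-free k l)) disjoint
    where
    disjoint : Disjoint sources Cs
    disjoint (p , q) with _ , _ , refl ← ∈-map⁻ _ p = All.lookup (cycles-middle undecided zero R) q
  es∈ : All (λ e → proj₁ e ∈ labels) es
  es∈ = All.++⁺ (All.map⁺ (All.universal (λ i → ∈-++⁺ˡ (∈-map⁺ inj₁ (∈-allFin i))) (allFin n)))
                (cycles-labels undecided zero R increasing)
  count : length es ≡ 2 ^ n ∸ n
  count = begin
    length es
      ≡⟨ List.length-++ sources ⟩
    length sources ℕ.+ length Cs
      ≡⟨ cong (ℕ._+ length Cs) (≡.trans (List.length-map _ (allFin n)) (List.length-tabulate {n = n} (λ i → i))) ⟩
    n ℕ.+ length Cs
      -- The sources supply one of the two copies of `n` in `cycles-length`; the other is added and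
      -- subtracted.
      ≡⟨ ℕ.m+n∸n≡m (n ℕ.+ length Cs) n ⟨
    (n ℕ.+ length Cs ℕ.+ n) ∸ n
      ≡⟨ cong (_∸ n) (rearrange n (length Cs)) ⟩
    (length Cs ℕ.+ 2 ℕ.* n) ∸ n
      ≡⟨ cong (_∸ n) total ⟩
    2 ^ n ∸ n ∎
    where
    open ≡.≡-Reasoning
    rearrange : ∀ n c → n ℕ.+ c ℕ.+ n ≡ c ℕ.+ 2 ℕ.* n
    rearrange = solve-∀
    total : length Cs ℕ.+ 2 ℕ.* n ≡ 2 ^ n
    total = ≡.subst (λ k → length Cs ℕ.+ 2 ℕ.* suc k ≡ 2 ^ suc k) (List.length-tabulate {n = m} suc)
              (cycles-length undecided zero R)
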